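{- Up to equivalence, there are exactly $8$ weighing matrices of order $12$ and weight $6$.
   Context: A weighing matrix of order $n$ and weight $k$ is an $n\times n$ matrix $W$ with entries in $\{1,-1,0\}$ such that $WW^T=kI_n$. Two weighing matrices $W_1,W_2$ of order $n$ are equivalent if $W_1=PW_2Q$ for some $n\times n$ monomial matrices $P,Q$ with nonzero entries in $\{1,-1\}$. -}

module Defs where

open import Data.Nat using (ℕ; zero; suc)
open import Data.Fin using (Fin; zero; suc)
open import Data.Integer using (ℤ; +_; -_; _+_; _*_)
open import Data.Product using (Σ; ∃; _×_; _,_)
open import Data.Sum using (_⊎_)
open import Relation.Binary.PropositionalEquality using (_≡_; _≢_)
open import Relation.Nullary using (yes; no)
open import Data.Fin using (_≟_)

Matrix : ℕ → Set
Matrix n = Fin n → Fin n → ℤ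

sumFin : (n : ℕ) → (Fin n → ℤ) → ℤ
sumFin zero    f = + 0
sumFin (suc n) f = f zero + sumFin n (λ i → f (suc i))

_·_ : {n : ℕ} → Matrix n → Matrix n → Matrix n
_·_ {n} A B i j = sumFin n (λ l → A i l * B l j)

_ᵀ : {n : ℕ} → Matrix n → Matrix n
(A ᵀ) i j = A j i

scalarId : (n : ℕ) → ℤ → Matrix n
scalarId n k i j with i ≟ j
... | yes _ = k
... | no  _ = + 0

IsTernary : ℤ → Set
IsTernary x = x ≡ + 1 ⊎ x ≡ - (+ 1) ⊎ x ≡ + 0

IsSign : ℤ → Set
IsSign x = x ≡ + 1 ⊎ x ≡ - (+ 1)

IsWeighing : (n k : ℕ) → Matrix n → Set
IsWeighing n k W = (∀ i j → IsTernary (W i j)) × (∀ i j → (W · (W ᵀ)) i j ≡ scalarId n (+ k) i j)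

IsSignedMonomial : (n : ℕ) → Matrix n → Set
IsSignedMonomial n M =
  (∀ i j → IsTernary (M i j)) ×
  (∀ i → ∃ λ j → IsSign (M i j) × (∀ j′ → M i j′ ≢ + 0 → j′ ≡ j)) ×
  (∀ j → ∃ λ i → IsSign (M i j) × (∀ i′ → M i′ j ≢ + 0 → i′ ≡ i))

Equivalent : (n : ℕ) → Matrix n → Matrix n → Set
Equivalent n W₁ W₂ =
  Σ (Matrix n) λ P → Σ (Matrix n) λ Q →
    IsSignedMonomial n P × IsSignedMonomial n Q ×
    (∀ i j → W₁ i j ≡ (P · (W₂ · Q)) i j)

{-# OPTIONS --safe #-}
-- Order ternary rows and matrices lexicographically with 1 < -1 < 0. By well-founded induction, any
-- signed rearrangement of rows and columns that makes M smaller settles M, so M may be assumed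
-- minimal wherever such a rearrangement is at hand. In particular its rows then form a strictly
-- increasing sequence of weight-6 vectors with leading entry 1, and M is built up row by row: once the
-- first rows p are chosen, the remaining ones form a sublist of the list C of all later candidates
-- orthogonal to p. A branch dies when C is too short, or when p itself can be made smaller: by an
-- exchange or negation of columns that is found directly, or by a row order recorded in a search tree,
-- followed by sorting the columns. Exactly eight leaves survive. They are pairwise inequivalent because
-- the number of ordered triples of rows with exactly two common support columns differs.

module Submission where

open import Defs
open import Algebra.Properties.CommutativeMonoid.Sum using (sum; sum-permute; sum-cong-≗)
open import Data.Bool using (Bool; true; false; if_then_else_; T; not; _∧_)
open import Data.Bool.Properties using (T-∧)
open import Data.Fin as Fin using (Fin; zero; suc; toℕ; _≟_; #_)
open import Data.Fin.Permutation as Perm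
  using (Permutation′; permutation; transpose; _⟨$⟩ʳ_; _⟨$⟩ˡ_; inverseʳ; inverseˡ; flip; _∘ₚ_)
import Data.Fin.Properties as Fin
open import Data.Integer as ℤ using (ℤ; +_; -_; _+_; _*_; ∣_∣)
import Data.Integer.Properties as ℤ
open import Data.Integer.Tactic.RingSolver using (solve-∀)
open import Data.List as List using (List; []; _∷_; _++_; length; filterᵇ)
import Data.List.Properties as List
open import Data.List.Membership.Propositional using (_∈_)
open import Data.List.Membership.Propositional.Properties using (∈-++⁺ˡ; ∈-++⁺ʳ; ∈-map⁺)
open import Data.List.Relation.Binary.Sublist.Propositional using (_⊆_; []; _∷_; _∷ʳ_; minimum)
open import Data.List.Relation.Unary.All as All using (All; []; _∷_)
import Data.List.Relation.Unary.All.Properties as All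
open import Data.List.Relation.Unary.AllPairs as AllPairs using (AllPairs; []; _∷_)
import Data.List.Relation.Unary.AllPairs.Properties as AllPairs
open import Data.List.Relation.Unary.Any using (here; there)
open import Data.Maybe as Maybe using (Maybe; just; nothing)
open import Data.Maybe.Relation.Unary.All as MaybeAll using (just; nothing)
import Data.Maybe.Relation.Unary.All.Properties as MaybeAll
open import Data.Nat as ℕ using (ℕ; zero; suc; _<ᵇ_; _≡ᵇ_)
open import Data.Nat.DivMod using (_mod_; _/_; _%_)
import Data.Nat.Properties as ℕ
open import Data.Product using (Σ; ∃; ∃₂; _×_; _,_; proj₁; proj₂; map₂)
open import Data.Sign as Sign using (Sign)
open import Data.Sum using (_⊎_; inj₁; inj₂)
open import Data.Vec as Vec using (Vec; []; _∷_; lookup; tabulate; toList)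
import Data.Vec.Properties as Vec
open import Data.Vec.Relation.Binary.Lex.Strict using (Lex-<; this; next; <-cmp; <-wellFounded; <-irrefl; <-trans)
open import Data.Vec.Relation.Binary.Pointwise.Inductive as Pointwise using (Pointwise; []; _∷_; Pointwise-≡⇒≡)
open import Function using (_∘_; Equivalence)
open import Induction.WellFounded using (WellFounded; Acc; acc)
open import Relation.Binary using (IsEquivalence; Trichotomous; tri<; tri≈; tri>; Transitive)
open import Relation.Binary.Consequences using (tri⇒dec≈)
open import Relation.Binary.PropositionalEquality
open import Relation.Nullary using (yes; no; ¬_; does; contradiction; Dec)
open import Relation.Nullary.Decidable using (decidable-stable; dec-true; dec-false; toWitness; _→-dec_)

open ≡-Reasoning

-- Finite sums

∑ : ∀ {n} → (Fin n → ℕ) → ℕ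
∑ = sum ℕ.+-0-commutativeMonoid

-- Makes `sum-permute` available for `sumFin`.
sumFin≡sum : ∀ n (f : Fin n → ℤ) → sumFin n f ≡ sum ℤ.+-0-commutativeMonoid f
sumFin≡sum zero    f = refl
sumFin≡sum (suc n) f = cong (_+_ (f zero)) (sumFin≡sum n (f ∘ suc))

sumFin-cong : ∀ n {f g : Fin n → ℤ} → (∀ i → f i ≡ g i) → sumFin n f ≡ sumFin n g
sumFin-cong zero    f≗g = refl
sumFin-cong (suc n) f≗g = cong₂ _+_ (f≗g zero) (sumFin-cong n (f≗g ∘ suc))

sumFin-permute : ∀ n (f : Fin n → ℤ) (π : Permutation′ n) → sumFin n f ≡ sumFin n (f ∘ (π ⟨$⟩ʳ_))
sumFin-permute n f π = begin
  sumFin n f                                      ≡⟨ sumFin≡sum n f ⟩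
  sum ℤ.+-0-commutativeMonoid f                   ≡⟨ sum-permute ℤ.+-0-commutativeMonoid f π ⟩
  sum ℤ.+-0-commutativeMonoid (f ∘ (π ⟨$⟩ʳ_))     ≡⟨ sumFin≡sum n _ ⟨
  sumFin n (f ∘ (π ⟨$⟩ʳ_))                        ∎

sumFin-*ˡ : ∀ n c (f : Fin n → ℤ) → sumFin n (λ i → c * f i) ≡ c * sumFin n f
sumFin-*ˡ zero    c f = sym (ℤ.*-zeroʳ c)
sumFin-*ˡ (suc n) c f = begin
  c * f zero + sumFin n (λ i → c * f (suc i))  ≡⟨ cong (_+_ (c * f zero)) (sumFin-*ˡ n c (f ∘ suc)) ⟩
  c * f zero + c * sumFin n (f ∘ suc)          ≡⟨ ℤ.*-distribˡ-+ c (f zero) (sumFin n (f ∘ suc)) ⟨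
  c * (f zero + sumFin n (f ∘ suc))            ∎

sumFin-zero : ∀ n {f : Fin n → ℤ} → (∀ i → f i ≡ + 0) → sumFin n f ≡ + 0
sumFin-zero zero    f≗0 = refl
sumFin-zero (suc n) f≗0 = cong₂ _+_ (f≗0 zero) (sumFin-zero n (f≗0 ∘ suc))

sumFin-single : ∀ n {f : Fin n → ℤ} k → (∀ i → i ≢ k → f i ≡ + 0) → sumFin n f ≡ f k
sumFin-single (suc n) {f} zero    off =
  trans (cong (_+_ (f zero)) (sumFin-zero n λ i → off (suc i) λ ())) (ℤ.+-identityʳ _)
sumFin-single (suc n) {f} (suc k) off =
  trans (cong₂ _+_ (off zero λ ()) (sumFin-single n k λ i i≢k → off (suc i) (i≢k ∘ Fin.suc-injective)))
        (ℤ.+-identityˡ _)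

-- Signed row and column permutations

-- Equivalence in coordinates: each monomial matrix is replaced by a permutation and a sign vector,
-- so that inverting and composing need no matrix products. The bracketing in `entry` follows
-- `P · (W₂ · Q)`.
record Similar {n} (A B : Matrix n) : Set where
  field
    rowPerm  : Permutation′ n
    rowSign  : Fin n → ℤ
    colPerm  : Permutation′ n
    colSign  : Fin n → ℤ
    isSignʳ  : ∀ i → IsSign (rowSign i)
    isSignᶜ  : ∀ j → IsSign (colSign j)
    entry    : ∀ i j → A i j ≡ rowSign i * (B (rowPerm ⟨$⟩ʳ i) (colPerm ⟨$⟩ʳ j) * colSign j)

sign² : ∀ {s} → IsSign s → s * s ≡ + 1
sign² (inj₁ refl) = refl
sign² (inj₂ refl) = refl

sign-* : ∀ {s t} → IsSign s → IsSign t → IsSign (s * t)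
sign-* (inj₁ refl) (inj₁ refl) = inj₁ refl
sign-* (inj₁ refl) (inj₂ refl) = inj₂ refl
sign-* (inj₂ refl) (inj₁ refl) = inj₂ refl
sign-* (inj₂ refl) (inj₂ refl) = inj₁ refl

pointwise-similar : ∀ {n} {A B : Matrix n} → (∀ i j → A i j ≡ B i j) → Similar A B
pointwise-similar {B = B} A≗B = record
  { rowPerm = Perm.id
  ; rowSign = λ _ → + 1
  ; colPerm = Perm.id
  ; colSign = λ _ → + 1
  ; isSignʳ = λ _ → inj₁ refl
  ; isSignᶜ = λ _ → inj₁ refl
  ; entry   = λ i j → trans (A≗B i j) (sym (trans (ℤ.*-identityˡ (B i j * + 1)) (ℤ.*-identityʳ (B i j))))
  }

similar-sym : ∀ {n} {A B : Matrix n} → Similar A B → Similar B A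
similar-sym {A = A} {B} e = record
  { rowPerm = flip rowPerm
  ; rowSign = λ i → rowSign (rowPerm ⟨$⟩ˡ i)
  ; colPerm = flip colPerm
  ; colSign = λ j → colSign (colPerm ⟨$⟩ˡ j)
  ; isSignʳ = λ i → isSignʳ (rowPerm ⟨$⟩ˡ i)
  ; isSignᶜ = λ j → isSignᶜ (colPerm ⟨$⟩ˡ j)
  ; entry   = λ i j → let s = rowSign (rowPerm ⟨$⟩ˡ i); t = colSign (colPerm ⟨$⟩ˡ j); b = B i j in sym (begin
      s * (A (rowPerm ⟨$⟩ˡ i) (colPerm ⟨$⟩ˡ j) * t)   ≡⟨ cong (λ a → s * (a * t)) (entry _ _) ⟩
      s * (s * (B (rowPerm ⟨$⟩ʳ (rowPerm ⟨$⟩ˡ i)) (colPerm ⟨$⟩ʳ (colPerm ⟨$⟩ˡ j)) * t) * t)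
        ≡⟨ cong₂ (λ k l → s * (s * (B k l * t) * t)) (inverseʳ rowPerm) (inverseʳ colPerm) ⟩
      s * (s * (b * t) * t)                           ≡⟨ regroup s t b ⟩
      (s * s) * (b * (t * t))
        ≡⟨ cong₂ (λ x y → x * (b * y)) (sign² (isSignʳ _)) (sign² (isSignᶜ _)) ⟩
      + 1 * (b * + 1)                                 ≡⟨ ℤ.*-identityˡ _ ⟩
      b * + 1                                         ≡⟨ ℤ.*-identityʳ b ⟩
      b                                               ∎)
  }
  where
  open Similar e
  regroup : ∀ s t b → s * (s * (b * t) * t) ≡ (s * s) * (b * (t * t))
  regroup = solve-∀

similar-trans : ∀ {n} {A B C : Matrix n} → Similar A B → Similar B C → Similar A C
similar-trans {C = C} d e = record
  { rowPerm = D.rowPerm ∘ₚ E.rowPerm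
  ; rowSign = λ i → D.rowSign i * E.rowSign (D.rowPerm ⟨$⟩ʳ i)
  ; colPerm = D.colPerm ∘ₚ E.colPerm
  ; colSign = λ j → E.colSign (D.colPerm ⟨$⟩ʳ j) * D.colSign j
  ; isSignʳ = λ i → sign-* (D.isSignʳ i) (E.isSignʳ _)
  ; isSignᶜ = λ j → sign-* (E.isSignᶜ _) (D.isSignᶜ j)
  ; entry   = λ i j → trans (D.entry i j) (trans
      (cong (λ b → D.rowSign i * (b * D.colSign j)) (E.entry _ _))
      (regroup (D.rowSign i) (E.rowSign _) (C _ _) (E.colSign _) (D.colSign j)))
  }
  where
  module D = Similar d
  module E = Similar e
  regroup : ∀ s s′ c t′ t → s * (s′ * (c * t′) * t) ≡ (s * s′) * (c * (t′ * t))
  regroup = solve-∀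

gram : ∀ {n} → Matrix n → Matrix n
gram A = A · (A ᵀ)

-- The column permutation only reindexes the inner product and the column signs square to 1. The row
-- signs factor out: they square to 1 on the diagonal and multiply 0 elsewhere.
similar-gram : ∀ {n k} {A B : Matrix n} → Similar A B →
               (∀ i j → gram B i j ≡ scalarId n k i j) → ∀ i j → gram A i j ≡ scalarId n k i j
similar-gram {n} {k} {A} {B} e gramB i j = begin
  sumFin n (λ l → A i l * A j l)                  ≡⟨ sumFin-cong n term ⟩
  sumFin n (λ l → (s * s′) * (B (ρ i) (τ l) * B (ρ j) (τ l)))
    ≡⟨ sumFin-*ˡ n (s * s′) (λ l → B (ρ i) (τ l) * B (ρ j) (τ l)) ⟩
  (s * s′) * sumFin n (λ l → B (ρ i) (τ l) * B (ρ j) (τ l))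
    ≡⟨ cong ((s * s′) *_) (sumFin-permute n (λ l → B (ρ i) l * B (ρ j) l) colPerm) ⟨
  (s * s′) * gram B (ρ i) (ρ j)                   ≡⟨ cong ((s * s′) *_) (gramB (ρ i) (ρ j)) ⟩
  (s * s′) * scalarId n k (ρ i) (ρ j)             ≡⟨ diagonal ⟩
  scalarId n k i j                                ∎
  where
  open Similar e
  ρ = rowPerm ⟨$⟩ʳ_
  τ = colPerm ⟨$⟩ʳ_
  s  = rowSign i
  s′ = rowSign j
  regroup : ∀ s b t s′ b′ → s * (b * t) * (s′ * (b′ * t)) ≡ (s * s′) * (b * b′ * (t * t))
  regroup = solve-∀
  term : ∀ l → A i l * A j l ≡ (s * s′) * (B (ρ i) (τ l) * B (ρ j) (τ l))
  term l = begin
    A i l * A j l                                            ≡⟨ cong₂ _*_ (entry i l) (entry j l) ⟩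
    s * (b * t) * (s′ * (b′ * t))                            ≡⟨ regroup s b t s′ b′ ⟩
    (s * s′) * (b * b′ * (t * t))                            ≡⟨ cong (λ x → (s * s′) * (b * b′ * x)) (sign² (isSignᶜ l)) ⟩
    (s * s′) * (b * b′ * + 1)                                ≡⟨ cong ((s * s′) *_) (ℤ.*-identityʳ (b * b′)) ⟩
    (s * s′) * (b * b′)                                      ∎
    where
    b = B (ρ i) (τ l)
    b′ = B (ρ j) (τ l)
    t = colSign l
  diagonal : (s * s′) * scalarId n k (ρ i) (ρ j) ≡ scalarId n k i j
  diagonal with i ≟ j | ρ i ≟ ρ j
  ... | yes refl | yes _     = trans (cong (_* k) (sign² (isSignʳ i))) (ℤ.*-identityˡ k)
  ... | yes refl | no ρi≢ρi  = contradiction refl ρi≢ρi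
  ... | no i≢j   | yes ρi≡ρj = contradiction
    (trans (sym (inverseˡ rowPerm)) (trans (cong (rowPerm ⟨$⟩ˡ_) ρi≡ρj) (inverseˡ rowPerm))) i≢j
  ... | no _     | no _      = ℤ.*-zeroʳ (s * s′)

sign-ternary : ∀ {s} → IsSign s → IsTernary s
sign-ternary (inj₁ p) = inj₁ p
sign-ternary (inj₂ p) = inj₂ (inj₁ p)

-- Row `i` has its only entry in column `π i`, so multiplying by this matrix from the left puts row
-- `π i` in place `i`.
signed : ∀ {n} → Permutation′ n → (Fin n → ℤ) → Matrix n
signed π s i j with π ⟨$⟩ʳ i ≟ j
... | yes _ = s i
... | no _  = + 0

signed-on : ∀ {n} (π : Permutation′ n) s i {j} → π ⟨$⟩ʳ i ≡ j → signed π s i j ≡ s i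
signed-on π s i {j} πi≡j with π ⟨$⟩ʳ i ≟ j
... | yes _   = refl
... | no πi≢j = contradiction πi≡j πi≢j

signed-off : ∀ {n} (π : Permutation′ n) s i {j} → π ⟨$⟩ʳ i ≢ j → signed π s i j ≡ + 0
signed-off π s i {j} πi≢j with π ⟨$⟩ʳ i ≟ j
... | yes πi≡j = contradiction πi≡j πi≢j
... | no _     = refl

signed-monomial : ∀ {n} (π : Permutation′ n) s → (∀ i → IsSign (s i)) → IsSignedMonomial n (signed π s)
signed-monomial {n} π s isSign = ternary , rows , columns
  where
  support : ∀ i j → signed π s i j ≢ + 0 → π ⟨$⟩ʳ i ≡ j
  support i j ≢0 = decidable-stable (π ⟨$⟩ʳ i ≟ j) λ πi≢j → ≢0 (signed-off π s i πi≢j)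
  ternary : ∀ i j → IsTernary (signed π s i j)
  ternary i j with π ⟨$⟩ʳ i ≟ j
  ... | yes _ = sign-ternary (isSign i)
  ... | no _  = inj₂ (inj₂ refl)
  rows : ∀ i → ∃ λ j → IsSign (signed π s i j) × (∀ j′ → signed π s i j′ ≢ + 0 → j′ ≡ j)
  rows i = π ⟨$⟩ʳ i , subst IsSign (sym (signed-on π s i refl)) (isSign i) , λ j′ ≢0 → sym (support i j′ ≢0)
  columns : ∀ j → ∃ λ i → IsSign (signed π s i j) × (∀ i′ → signed π s i′ j ≢ + 0 → i′ ≡ i)
  columns j = π ⟨$⟩ˡ j , subst IsSign (sym (signed-on π s _ (inverseʳ π))) (isSign _)
    , λ i′ ≢0 → trans (sym (inverseˡ π)) (cong (π ⟨$⟩ˡ_) (support i′ j ≢0))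

-- Both sums collapse to a single term, since row `i` of `P` and column `j` of `Q` vanish off one
-- position.
monomial-product : ∀ {n} (P B Q : Matrix n) i j r c →
                   (∀ l → l ≢ r → P i l ≡ + 0) → (∀ m → m ≢ c → Q m j ≡ + 0) →
                   (P · (B · Q)) i j ≡ P i r * (B r c * Q c j)
monomial-product {n} P B Q i j r c P-off Q-off = begin
  sumFin n (λ l → P i l * sumFin n (λ m → B l m * Q m j))
    ≡⟨ sumFin-single n r (λ l l≢r → cong (_* sumFin n (λ m → B l m * Q m j)) (P-off l l≢r)) ⟩
  P i r * sumFin n (λ m → B r m * Q m j)
    ≡⟨ cong (P i r *_) (sumFin-single n c λ m m≢c → trans (cong (B r m *_) (Q-off m m≢c)) (ℤ.*-zeroʳ (B r m))) ⟩
  P i r * (B r c * Q c j)  ∎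

similar⇒equivalent : ∀ {n} {A B : Matrix n} → Similar A B → Equivalent n A B
similar⇒equivalent {n} {A} {B} e =
  P , Q , signed-monomial rowPerm rowSign isSignʳ , signed-monomial (flip colPerm) colSign⁻ (λ _ → isSignᶜ _) , product
  where
  open Similar e
  -- As a right factor, `Q` must have its entry of column `j` in row `colPerm j`. Read by rows this
  -- is the inverse permutation, and the signs are reindexed accordingly.
  colSign⁻ = λ m → colSign (colPerm ⟨$⟩ˡ m)
  P = signed rowPerm rowSign
  Q = signed (flip colPerm) colSign⁻
  product : ∀ i j → A i j ≡ (P · (B · Q)) i j
  product i j = begin
    A i j                                    ≡⟨ entry i j ⟩
    rowSign i * (B r c * colSign j)          ≡⟨ cong₂ (λ x y → x * (B r c * y)) (signed-on rowPerm rowSign i refl) Q-on ⟨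
    P i r * (B r c * Q c j)                  ≡⟨ monomial-product P B Q i j r c P-off Q-off ⟨
    (P · (B · Q)) i j                        ∎
    where
    r = rowPerm ⟨$⟩ʳ i
    c = colPerm ⟨$⟩ʳ j
    Q-on : Q c j ≡ colSign j
    Q-on = trans (signed-on (flip colPerm) colSign⁻ c (inverseˡ colPerm)) (cong colSign (inverseˡ colPerm))
    P-off : ∀ l → l ≢ r → P i l ≡ + 0
    P-off l l≢r = signed-off rowPerm rowSign i (l≢r ∘ sym)
    Q-off : ∀ m → m ≢ c → Q m j ≡ + 0
    Q-off m m≢c = signed-off (flip colPerm) colSign⁻ m λ eq → m≢c (trans (sym (inverseʳ colPerm)) (cong (colPerm ⟨$⟩ʳ_) eq))

sign≢0 : ∀ {s} → IsSign s → s ≢ + 0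
sign≢0 (inj₁ refl) ()
sign≢0 (inj₂ refl) ()

equivalent⇒similar : ∀ {n} {A B : Matrix n} → Equivalent n A B → Similar A B
equivalent⇒similar {n} {A} {B} (P , Q , (_ , P-row , P-col) , (_ , Q-row , Q-col) , product) = record
  -- The position maps given by the rows and by the columns of a monomial matrix are mutually
  -- inverse, because a nonzero entry is the only one in its row and in its column.
  { rowPerm = permutation (λ i → proj₁ (P-row i)) (λ j → proj₁ (P-col j))
      (λ j → sym (proj₂ (proj₂ (P-row _)) j (sign≢0 (proj₁ (proj₂ (P-col j))))))
      (λ i → sym (proj₂ (proj₂ (P-col _)) i (sign≢0 (proj₁ (proj₂ (P-row i))))))
  ; rowSign = λ i → P i (proj₁ (P-row i))
  ; colPerm = permutation (λ j → proj₁ (Q-col j)) (λ i → proj₁ (Q-row i))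
      (λ i → sym (proj₂ (proj₂ (Q-col _)) i (sign≢0 (proj₁ (proj₂ (Q-row i))))))
      (λ j → sym (proj₂ (proj₂ (Q-row _)) j (sign≢0 (proj₁ (proj₂ (Q-col j))))))
  ; colSign = λ j → Q (proj₁ (Q-col j)) j
  ; isSignʳ = λ i → proj₁ (proj₂ (P-row i))
  ; isSignᶜ = λ j → proj₁ (proj₂ (Q-col j))
  ; entry   = λ i j → trans (product i j) (monomial-product P B Q i j _ _
      -- Monomiality says that nonzero entries sit at one position; since equality with 0 is
      -- decidable, the entries elsewhere are 0.
      (λ l l≢r → decidable-stable (P i l ℤ.≟ + 0) (l≢r ∘ proj₂ (proj₂ (P-row i)) l))
      (λ m m≢c → decidable-stable (Q m j ℤ.≟ + 0) (m≢c ∘ proj₂ (proj₂ (Q-col j)) m)))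
  }

-- An invariant: common supports of row triples

tripleCount : ∀ {n} → (Fin n → Fin n → ℕ) → ℕ
-- For a 0-1 matrix the inner sum counts the columns common to three rows. Triples with repeated
-- rows are included.
tripleCount B = ∑ λ i → ∑ λ j → ∑ λ k → if (∑ λ l → B i l ℕ.* B j l ℕ.* B k l) ℕ.≡ᵇ 2 then 1 else 0

∑-cong : ∀ {n} {f g : Fin n → ℕ} → (∀ i → f i ≡ g i) → ∑ f ≡ ∑ g
∑-cong = sum-cong-≗ ℕ.+-0-commutativeMonoid

∑-permute : ∀ {n} (π : Permutation′ n) {f : Fin n → ℕ} → ∑ (f ∘ (π ⟨$⟩ʳ_)) ≡ ∑ f
∑-permute π {f} = sym (sum-permute ℕ.+-0-commutativeMonoid f π)

tripleCount-permute : ∀ {n} (A B : Fin n → Fin n → ℕ) (ρ τ : Permutation′ n) →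
  (∀ i j → A i j ≡ B (ρ ⟨$⟩ʳ i) (τ ⟨$⟩ʳ j)) → tripleCount A ≡ tripleCount B
tripleCount-permute A B ρ τ eq =
  trans (∑-cong λ i → trans (∑-cong λ j → trans (∑-cong λ k →
    cong (λ m → if m ℕ.≡ᵇ 2 then 1 else 0) (trans
      (∑-cong λ l → cong₂ ℕ._*_ (cong₂ ℕ._*_ (eq i l) (eq j l)) (eq k l))
      (∑-permute τ {λ l → B (ρ ⟨$⟩ʳ i) l ℕ.* B (ρ ⟨$⟩ʳ j) l ℕ.* B (ρ ⟨$⟩ʳ k) l})))
    (∑-permute ρ {λ k → f (i′ i) (i′ j) k})) (∑-permute ρ {λ j → ∑ (f (i′ i) j)})) (∑-permute ρ {λ i → ∑ λ j → ∑ (f i j)})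
  where
  i′ = ρ ⟨$⟩ʳ_
  f : _ → _ → _ → ℕ
  f i j k = if (∑ λ l → B i l ℕ.* B j l ℕ.* B k l) ℕ.≡ᵇ 2 then 1 else 0

abs-signed : ∀ {s t} b → IsSign s → IsSign t → ∣ s * (b * t) ∣ ≡ ∣ b ∣
abs-signed {s} {t} b s-sign t-sign = begin
  ∣ s * (b * t) ∣             ≡⟨ ℤ.abs-* s (b * t) ⟩
  ∣ s ∣ ℕ.* ∣ b * t ∣         ≡⟨ cong (∣ s ∣ ℕ.*_) (ℤ.abs-* b t) ⟩
  ∣ s ∣ ℕ.* (∣ b ∣ ℕ.* ∣ t ∣)  ≡⟨ cong₂ (λ x y → x ℕ.* (∣ b ∣ ℕ.* y)) (one s-sign) (one t-sign) ⟩
  1 ℕ.* (∣ b ∣ ℕ.* 1)         ≡⟨ ℕ.*-identityˡ _ ⟩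
  ∣ b ∣ ℕ.* 1                 ≡⟨ ℕ.*-identityʳ _ ⟩
  ∣ b ∣                       ∎
  where
  one : ∀ {s} → IsSign s → ∣ s ∣ ≡ 1
  one (inj₁ refl) = refl
  one (inj₂ refl) = refl

supportTriples : ∀ {n} → Matrix n → ℕ
supportTriples A = tripleCount λ i j → ∣ A i j ∣

-- Absolute values erase all signs; what remains are permutations, which reindex the sums.
similar-supportTriples : ∀ {n} {A B : Matrix n} → Similar A B → supportTriples A ≡ supportTriples B
similar-supportTriples {B = B} e = tripleCount-permute _ (λ i j → ∣ B i j ∣) rowPerm colPerm λ i j →
  trans (cong ∣_∣ (entry i j)) (abs-signed (B _ _) (isSignʳ i) (isSignᶜ j))
  where open Similar e

-- Ternary rows and their lexicographic order

data Trit : Set where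
  pos neg nil : Trit

⟦_⟧ : Trit → ℤ
⟦ pos ⟧ = + 1
⟦ neg ⟧ = - (+ 1)
⟦ nil ⟧ = + 0

-- With zero as the largest entry, small rows carry their nonzero entries early.
data _≺_ : Trit → Trit → Set where
  pos≺neg : pos ≺ neg
  pos≺nil : pos ≺ nil
  neg≺nil : neg ≺ nil

≺-compare : Trichotomous _≡_ _≺_
≺-compare pos pos = tri≈ (λ ()) refl (λ ())
≺-compare pos neg = tri< pos≺neg (λ ()) (λ ())
≺-compare pos nil = tri< pos≺nil (λ ()) (λ ())
≺-compare neg pos = tri> (λ ()) (λ ()) pos≺neg
≺-compare neg neg = tri≈ (λ ()) refl (λ ())
≺-compare neg nil = tri< neg≺nil (λ ()) (λ ())
≺-compare nil pos = tri> (λ ()) (λ ()) pos≺nil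
≺-compare nil neg = tri> (λ ()) (λ ()) neg≺nil
≺-compare nil nil = tri≈ (λ ()) refl (λ ())

≺-trans : Transitive _≺_
≺-trans pos≺neg neg≺nil = pos≺nil

≺-irrefl : ∀ {x y} → x ≡ y → ¬ x ≺ y
≺-irrefl refl ()

≺-wellFounded : WellFounded _≺_
≺-wellFounded nil = acc λ { pos≺nil → ≺-pos ; neg≺nil → acc λ { pos≺neg → ≺-pos } }
  where ≺-pos = acc λ ()
≺-wellFounded neg = acc λ { pos≺neg → acc λ () }
≺-wellFounded pos = acc λ ()

Row : Set
Row = Vec Trit 12

_<ᵣ_ : ∀ {n} → Vec Trit n → Vec Trit n → Set
_<ᵣ_ = Lex-< _≡_ _≺_

_<ₘ_ : ∀ {n} → Vec Row n → Vec Row n → Set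
_<ₘ_ = Lex-< _≡_ _<ᵣ_

<ᵣ-compare : ∀ {n} → Trichotomous (Pointwise _≡_) (_<ᵣ_ {n})
<ᵣ-compare = <-cmp sym ≺-compare

<ᵣ-irrefl : ∀ {n} {u : Vec Trit n} → ¬ u <ᵣ u
<ᵣ-irrefl = <-irrefl ≺-irrefl (Pointwise.refl refl)

<ᵣ-trans : ∀ {n} → Transitive (_<ᵣ_ {n})
<ᵣ-trans = <-trans (IsEquivalence.isPartialEquivalence isEquivalence) (resp₂ _≺_) ≺-trans

-- The lexicographic order on vectors of a fixed length inherits well-foundedness from the entries;
-- this is applied to rows and then to matrices.
<ₘ-wellFounded : ∀ {n} → WellFounded (_<ₘ_ {n})
<ₘ-wellFounded = <-wellFounded trans (proj₁ (resp₂ _<ᵣ_)) (<-wellFounded trans (proj₁ (resp₂ _≺_)) ≺-wellFounded)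

<ₘ-at : ∀ {n} {A B : Vec Row n} i → (∀ {k} → k Fin.< i → lookup A k ≡ lookup B k) →
        lookup A i <ᵣ lookup B i → A <ₘ B
<ₘ-at {A = _ ∷ _} {_ ∷ _} zero    same less = this less refl
<ₘ-at {A = _ ∷ _} {_ ∷ _} (suc i) same less = next (same ℕ.z<s) (<ₘ-at i (same ∘ ℕ.s<s) less)

-- Signed rearrangements of ternary matrices

infixr 7 _•_
_•_ : Sign → Trit → Trit
Sign.+ • x   = x
Sign.- • pos = neg
Sign.- • neg = pos
Sign.- • nil = nil

record Move : Set where
  constructor move
  field
    rowPerm : Permutation′ 12
    rowSign : Fin 12 → Sign
    colPerm : Permutation′ 12
    colSign : Fin 12 → Sign

open Move

-- The old row is an argument, so that a move can be applied while only some rows of the matrix are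
-- known.
moveRow : Move → Fin 12 → Row → Row
moveRow g i u = tabulate λ j → (rowSign g i Sign.* colSign g j) • lookup u (colPerm g ⟨$⟩ʳ j)

act : Move → Vec Row 12 → Vec Row 12
act g M = tabulate λ i → moveRow g i (lookup M (rowPerm g ⟨$⟩ʳ i))

lookup-moveRow : ∀ g i u j → lookup (moveRow g i u) j ≡ (rowSign g i Sign.* colSign g j) • lookup u (colPerm g ⟨$⟩ʳ j)
lookup-moveRow g i u = Vec.lookup∘tabulate (λ j → (rowSign g i Sign.* colSign g j) • lookup u (colPerm g ⟨$⟩ʳ j))

lookup-act : ∀ g M i → lookup (act g M) i ≡ moveRow g i (lookup M (rowPerm g ⟨$⟩ʳ i))
lookup-act g M = Vec.lookup∘tabulate (λ i → moveRow g i (lookup M (rowPerm g ⟨$⟩ʳ i)))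

toMatrix : ∀ {n} → Vec (Vec Trit n) n → Matrix n
toMatrix M i j = ⟦ lookup (lookup M i) j ⟧

signℤ : Sign → ℤ
signℤ Sign.+ = + 1
signℤ Sign.- = - (+ 1)

signℤ-isSign : ∀ s → IsSign (signℤ s)
signℤ-isSign Sign.+ = inj₁ refl
signℤ-isSign Sign.- = inj₂ refl

⟦•⟧ : ∀ s t x → ⟦ (s Sign.* t) • x ⟧ ≡ signℤ s * (⟦ x ⟧ * signℤ t)
⟦•⟧ Sign.+ Sign.+ pos = refl
⟦•⟧ Sign.+ Sign.+ neg = refl
⟦•⟧ Sign.+ Sign.+ nil = refl
⟦•⟧ Sign.+ Sign.- pos = refl
⟦•⟧ Sign.+ Sign.- neg = refl
⟦•⟧ Sign.+ Sign.- nil = refl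
⟦•⟧ Sign.- Sign.+ pos = refl
⟦•⟧ Sign.- Sign.+ neg = refl
⟦•⟧ Sign.- Sign.+ nil = refl
⟦•⟧ Sign.- Sign.- pos = refl
⟦•⟧ Sign.- Sign.- neg = refl
⟦•⟧ Sign.- Sign.- nil = refl

act-similar : ∀ g M → Similar (toMatrix (act g M)) (toMatrix M)
act-similar g M = record
  { rowPerm = rowPerm g
  ; rowSign = signℤ ∘ rowSign g
  ; colPerm = colPerm g
  ; colSign = signℤ ∘ colSign g
  ; isSignʳ = signℤ-isSign ∘ rowSign g
  ; isSignᶜ = signℤ-isSign ∘ colSign g
  ; entry   = λ i j → trans
      (cong ⟦_⟧ (trans (cong (λ u → lookup u j) (lookup-act g M i)) (lookup-moveRow g i (lookup M (rowPerm g ⟨$⟩ʳ i)) j)))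
      (⟦•⟧ (rowSign g i) (colSign g j) (lookup (lookup M (rowPerm g ⟨$⟩ʳ i)) (colPerm g ⟨$⟩ʳ j)))
  }

-- Improving a matrix of which only the first rows are known

infixl 9 _‼_
_‼_ : ∀ {A : Set} → List A → ℕ → Maybe A
[]       ‼ _     = nothing
(x ∷ xs) ‼ zero  = just x
(x ∷ xs) ‼ suc n = xs ‼ n

-- Beyond the prefix the lookup is `nothing`, about which `MaybeAll.All` claims nothing.
‼-prefix : ∀ {A : Set} {n} (xs : Vec A n) p {q} → toList xs ≡ p ++ q →
           ∀ i → MaybeAll.All (_≡ lookup xs i) (p ‼ toℕ i)
‼-prefix (x ∷ xs) []       eq i       = nothing
‼-prefix (x ∷ xs) (y ∷ p) eq zero    = just (sym (List.∷-injectiveˡ eq))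
‼-prefix (x ∷ xs) (y ∷ p) eq (suc i) = ‼-prefix xs p (List.∷-injectiveʳ eq) i

-- Reaching an unknown row, or the end of the known rows, before a strict decrease counts as
-- failure. A positive answer therefore does not depend on the unknown rows.
precedes : ∀ {n} → Vec (Maybe Row) n → List Row → Bool
precedes []             _        = false
precedes (_ ∷ _)        []       = false
precedes (nothing ∷ _)  (_ ∷ _)  = false
precedes (just u ∷ us)  (v ∷ vs) with <ᵣ-compare u v
... | tri< _ _ _ = true
... | tri≈ _ _ _ = precedes us vs
... | tri> _ _ _ = false

precedes-sound : ∀ {n} {us : Vec (Maybe Row) n} {A B : Vec Row n} p {q} →
                 Pointwise (λ a → MaybeAll.All (_≡ a)) A us → toList B ≡ p ++ q → T (precedes us p) → A <ₘ B
precedes-sound {B = _ ∷ _} (v ∷ vs) (just {x = u} refl ∷ rest) eq ok with <ᵣ-compare u v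
... | tri< u<v _ _ = this (subst (u <ᵣ_) (sym (List.∷-injectiveˡ eq)) u<v) refl
... | tri≈ _ u≋v _ = next (trans (Pointwise-≡⇒≡ u≋v) (sym (List.∷-injectiveˡ eq)))
                          (precedes-sound vs rest (List.∷-injectiveʳ eq) ok)

improves : Move → List Row → Bool
improves g p = precedes (tabulate λ i → Maybe.map (moveRow g i) (p ‼ toℕ (rowPerm g ⟨$⟩ʳ i))) p

-- Since the decrease happens within known rows, one evaluation on `p` covers every matrix that
-- begins with `p`.
improves-sound : ∀ g (M : Vec Row 12) p {q} → toList M ≡ p ++ q → T (improves g p) → act g M <ₘ M
improves-sound g M p eq = precedes-sound p
  (Pointwise.tabulate⁺ λ i → MaybeAll.map⁺ (MaybeAll.map (cong (moveRow g i)) (‼-prefix M p eq (rowPerm g ⟨$⟩ʳ i)))) eq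

-- Orthogonality of ternary rows

-- The accumulators count the columns in which the two vectors agree, respectively differ in sign.
balanced : ∀ {n} → ℕ → ℕ → Vec Trit n → Vec Trit n → Bool
balanced a b []         []         = a ≡ᵇ b
balanced a b (nil ∷ xs) (_   ∷ ys) = balanced a b xs ys
balanced a b (pos ∷ xs) (nil ∷ ys) = balanced a b xs ys
balanced a b (pos ∷ xs) (pos ∷ ys) = balanced (suc a) b xs ys
balanced a b (pos ∷ xs) (neg ∷ ys) = balanced a (suc b) xs ys
balanced a b (neg ∷ xs) (nil ∷ ys) = balanced a b xs ys
balanced a b (neg ∷ xs) (pos ∷ ys) = balanced a (suc b) xs ys
balanced a b (neg ∷ xs) (neg ∷ ys) = balanced (suc a) b xs ys

orthogonal : Row → Row → Bool
orthogonal = balanced 0 0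

Orthogonal : Row → Row → Set
Orthogonal u v = T (orthogonal u v)

⟨_,_⟩ : ∀ {n} → Vec Trit n → Vec Trit n → ℤ
⟨_,_⟩ {n} u v = sumFin n λ l → ⟦ lookup u l ⟧ * ⟦ lookup v l ⟧

-- The difference of the accumulators is the part of the inner product already read, so the
-- hypothesis is preserved by the recursion; at the end it reads `a` = `b`. Hence filtering by
-- `orthogonal` never loses a row of the matrix.
balanced-complete : ∀ {n} a b (u v : Vec Trit n) → + a + - (+ b) + ⟨ u , v ⟩ ≡ + 0 → T (balanced a b u v)
balanced-complete a b [] [] eq =
  ℕ.≡⇒≡ᵇ a b (ℤ.+-injective (ℤ.i-j≡0⇒i≡j (+ a) (+ b) (trans (sym (ℤ.+-identityʳ _)) eq)))
balanced-complete a b (x ∷ xs) (y ∷ ys) eq = step x y eq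
  where
  drop : ∀ z → + a + - (+ b) + (+ 0 + z) ≡ + a + - (+ b) + z
  drop z = cong (_+_ (+ a + - (+ b))) (ℤ.+-identityˡ z)
  up : ∀ c d z → c + - d + (+ 1 + z) ≡ + 1 + c + - d + z
  up = solve-∀
  down : ∀ c d z → c + - d + (- (+ 1) + z) ≡ c + - (+ 1 + d) + z
  down = solve-∀
  s = ⟨ xs , ys ⟩
  step : ∀ x y → + a + - (+ b) + (⟦ x ⟧ * ⟦ y ⟧ + s) ≡ + 0 → T (balanced a b (x ∷ xs) (y ∷ ys))
  step nil y   eq = balanced-complete a b xs ys
    (trans (sym (trans (cong (λ z → + a + - (+ b) + (z + s)) (ℤ.*-zeroˡ ⟦ y ⟧)) (drop s))) eq)
  step pos nil eq = balanced-complete a b xs ys (trans (sym (drop s)) eq)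
  step pos pos eq = balanced-complete (suc a) b xs ys (trans (sym (up (+ a) (+ b) s)) eq)
  step pos neg eq = balanced-complete a (suc b) xs ys (trans (sym (down (+ a) (+ b) s)) eq)
  step neg nil eq = balanced-complete a b xs ys (trans (sym (drop s)) eq)
  step neg pos eq = balanced-complete a (suc b) xs ys (trans (sym (down (+ a) (+ b) s)) eq)
  step neg neg eq = balanced-complete (suc a) b xs ys (trans (sym (up (+ a) (+ b) s)) eq)

orthogonal-complete : ∀ u v → ⟨ u , v ⟩ ≡ + 0 → Orthogonal u v
orthogonal-complete u v eq = balanced-complete 0 0 u v (trans (ℤ.+-identityˡ _) eq)

-- Enumeration of the rows of given weight

weight : ∀ {n} → Vec Trit n → ℕ
weight []         = 0
weight (pos ∷ xs) = suc (weight xs)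
weight (neg ∷ xs) = suc (weight xs)
weight (nil ∷ xs) = weight xs

norm≡weight : ∀ {n} (u : Vec Trit n) → ⟨ u , u ⟩ ≡ + weight u
norm≡weight []         = refl
norm≡weight (pos ∷ xs) = cong (_+_ (+ 1)) (norm≡weight xs)
norm≡weight (neg ∷ xs) = cong (_+_ (+ 1)) (norm≡weight xs)
norm≡weight (nil ∷ xs) = trans (ℤ.+-identityˡ _) (norm≡weight xs)

-- The blocks follow the order of `≺`, which makes the list increasing.
vectors : ∀ n → ℕ → List (Vec Trit n)
vectors zero    zero    = [] ∷ []
vectors zero    (suc k) = []
vectors (suc n) zero    = List.map (nil ∷_) (vectors n zero)
vectors (suc n) (suc k) =
  List.map (pos ∷_) (vectors n k) ++ List.map (neg ∷_) (vectors n k) ++ List.map (nil ∷_) (vectors n (suc k))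

-- The first nonzero entry is `pos`, which selects one vector from each pair `u`, `negate u`.
normalised : ∀ n → ℕ → List (Vec Trit n)
normalised zero    _       = []
normalised (suc n) zero    = []
normalised (suc n) (suc k) = List.map (pos ∷_) (vectors n k) ++ List.map (nil ∷_) (normalised n (suc k))

∈-vectors : ∀ {n} (u : Vec Trit n) → u ∈ vectors n (weight u)
∈-vectors []         = here refl
∈-vectors (pos ∷ xs) = ∈-++⁺ˡ (∈-map⁺ (pos ∷_) (∈-vectors xs))
∈-vectors {suc n} (neg ∷ xs) =
  ∈-++⁺ʳ (List.map (pos ∷_) (vectors n (weight xs))) (∈-++⁺ˡ (∈-map⁺ (neg ∷_) (∈-vectors xs)))
∈-vectors {suc n} (nil ∷ xs) with weight xs | ∈-vectors xs
... | zero  | xs∈ = ∈-map⁺ (nil ∷_) xs∈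
... | suc k | xs∈ = ∈-++⁺ʳ (List.map (pos ∷_) (vectors n k)) (∈-++⁺ʳ (List.map (neg ∷_) (vectors n k)) (∈-map⁺ (nil ∷_) xs∈))

negate : ∀ {n} → Vec Trit n → Vec Trit n
negate = Vec.map (Sign.- •_)

-- Negation fixes the leading zeros. If the entry after them is `neg` it becomes `pos`, a strict
-- decrease.
normalised-or-negate : ∀ {n k} (u : Vec Trit n) → weight u ≡ suc k → u ∈ normalised n (suc k) ⊎ negate u <ᵣ u
normalised-or-negate (pos ∷ xs) refl = inj₁ (∈-++⁺ˡ (∈-map⁺ (pos ∷_) (∈-vectors xs)))
normalised-or-negate (neg ∷ xs) eq   = inj₂ (this pos≺neg refl)
normalised-or-negate {suc n} {k} (nil ∷ xs) eq with normalised-or-negate xs eq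
... | inj₁ xs∈    = inj₁ (∈-++⁺ʳ (List.map (pos ∷_) (vectors n k)) (∈-map⁺ (nil ∷_) xs∈))
... | inj₂ neg<xs = inj₂ (next refl neg<xs)

heads-below : ∀ {n x y} (us vs : List (Vec Trit n)) → x ≺ y →
              All (λ u → All (u <ᵣ_) (List.map (y ∷_) vs)) (List.map (x ∷_) us)
heads-below us vs x≺y = All.map⁺ (All.universal (λ _ → All.map⁺ (All.universal (λ _ → this x≺y refl) vs)) us)

∷-sorted : ∀ {n} x {us : List (Vec Trit n)} → AllPairs _<ᵣ_ us → AllPairs _<ᵣ_ (List.map (x ∷_) us)
∷-sorted x = AllPairs.map⁺ ∘ AllPairs.map (next refl)

vectors-sorted : ∀ n k → AllPairs _<ᵣ_ (vectors n k)
vectors-sorted zero    zero    = [] ∷ []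
vectors-sorted zero    (suc k) = []
vectors-sorted (suc n) zero    = ∷-sorted nil (vectors-sorted n zero)
vectors-sorted (suc n) (suc k) = AllPairs.++⁺ (∷-sorted pos (vectors-sorted n k))
  (AllPairs.++⁺ (∷-sorted neg (vectors-sorted n k)) (∷-sorted nil (vectors-sorted n (suc k)))
    (heads-below us vs neg≺nil))
  (All.zipWith (λ (p , q) → All.++⁺ p q) (heads-below us us pos≺neg , heads-below us vs pos≺nil))
  where
  us = vectors n k
  vs = vectors n (suc k)

normalised-sorted : ∀ n k → AllPairs _<ᵣ_ (normalised n k)
normalised-sorted zero    k       = []
normalised-sorted (suc n) zero    = []
normalised-sorted (suc n) (suc k) = AllPairs.++⁺ (∷-sorted pos (vectors-sorted n k))
  (∷-sorted nil (normalised-sorted n (suc k))) (heads-below (vectors n k) (normalised n (suc k)) pos≺nil)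

-- Increasing lists can be compared in one pass: once the head of `vs` is matched or skipped, it
-- cannot occur later in `us`. Containment thus becomes an order-preserving embedding, along which
-- the search can recurse.
sorted-⊆ : ∀ {n} {us vs : List (Vec Trit n)} → AllPairs _<ᵣ_ us → AllPairs _<ᵣ_ vs → All (_∈ vs) us → us ⊆ vs
sorted-⊆ {us = us}     {[]}     _          _          []             = []
sorted-⊆ {us = us}     {[]}     _          _          (() ∷ _)
sorted-⊆ {us = []}     {v ∷ vs} _          _          _              = minimum _
sorted-⊆ {us = u ∷ us} {v ∷ vs} (u< ∷ us↑) (v< ∷ vs↑) (here refl ∷ us∈) =
  refl ∷ sorted-⊆ us↑ vs↑ (All.zipWith later (u< , us∈))
  where
  later : ∀ {w} → v <ᵣ w × w ∈ v ∷ vs → w ∈ vs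
  later (v<w , here refl)  = contradiction v<w <ᵣ-irrefl
  later (v<w , there w∈vs) = w∈vs
sorted-⊆ {us = u ∷ us} {v ∷ vs} (u< ∷ us↑) (v< ∷ vs↑) (there u∈vs ∷ us∈) =
  v ∷ʳ sorted-⊆ (u< ∷ us↑) vs↑ (u∈vs ∷ All.zipWith later (u< , us∈))
  where
  later : ∀ {w} → u <ᵣ w × w ∈ v ∷ vs → w ∈ vs
  later (u<w , here refl)  = contradiction (<ᵣ-trans u<w (All.lookup v< u∈vs)) <ᵣ-irrefl
  later (u<w , there w∈vs) = w∈vs

-- The representatives: one decimal digit per entry, 2 standing for -1.

trit : ℕ → Trit
trit 1 = pos
trit 2 = neg
trit _ = nil

row : ℕ → Row
-- Digits are read from the last one backwards, and always twelve of them, so the leading zeros of a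
-- literal come back as `nil`.
row k = Vec.reverse (go 12 k)
  where
  go : ∀ n → ℕ → Vec Trit n
  go zero    _ = []
  go (suc n) k = trit (k % 10) ∷ go n (k / 10)

-- Listed in the order in which the search reaches them.
digits : Vec (Vec ℕ 12) 8
digits =
  (111111000000 ∷ 111222000000 ∷ 120120110000 ∷ 120210120000 ∷ 102000201110 ∷ 102000202220 ∷
   012000101201 ∷ 012000102102 ∷ 000102021022 ∷ 000102022011 ∷ 000012010121 ∷ 000012010212 ∷ []) ∷
  (111111000000 ∷ 111222000000 ∷ 120120110000 ∷ 120210001100 ∷ 102102220000 ∷ 102201002200 ∷
   012000101011 ∷ 012000010122 ∷ 000012102012 ∷ 000012010221 ∷ 000000121222 ∷ 000000122121 ∷ []) ∷
  (111111000000 ∷ 111222000000 ∷ 120120110000 ∷ 120201201000 ∷ 102012000110 ∷ 102000022220 ∷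
   012021000101 ∷ 012000011202 ∷ 000120220012 ∷ 000102201021 ∷ 000000121122 ∷ 000000121211 ∷ []) ∷
  (111111000000 ∷ 112200110000 ∷ 110022220000 ∷ 121200001100 ∷ 122100000011 ∷ 120000002222 ∷
   001122110000 ∷ 001200002211 ∷ 000012121200 ∷ 000012210012 ∷ 000012002121 ∷ 000000122112 ∷ []) ∷
  (111111000000 ∷ 112200110000 ∷ 110022220000 ∷ 121200001100 ∷ 122010202000 ∷ 120120100200 ∷
   001200002211 ∷ 001002012022 ∷ 000102010111 ∷ 000012120012 ∷ 000012001221 ∷ 000000122121 ∷ []) ∷
  (111111000000 ∷ 112200110000 ∷ 121020101000 ∷ 120210200100 ∷ 102120200010 ∷ 100002022220 ∷
   011220200001 ∷ 010002021102 ∷ 001002012012 ∷ 000102010121 ∷ 000012001211 ∷ 000000122111 ∷ []) ∷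
  (111111000000 ∷ 112200110000 ∷ 121020101000 ∷ 120210200100 ∷ 102102020010 ∷ 100020202220 ∷
   011202020001 ∷ 010020201102 ∷ 001002012012 ∷ 000102010121 ∷ 000012001222 ∷ 000000122122 ∷ []) ∷
  (111111000000 ∷ 112200110000 ∷ 121020101000 ∷ 120012002100 ∷ 102000221010 ∷ 100020202220 ∷
   011202020001 ∷ 010122000102 ∷ 001200210012 ∷ 000102010211 ∷ 000012001222 ∷ 000000122212 ∷ []) ∷
  []

table : Fin 8 → Vec Row 12
table a = Vec.map row (Vec.lookup digits a)

-- The search

plus : Fin 12 → Sign
plus _ = Sign.+

minusAt : Fin 12 → Fin 12 → Sign
minusAt j k = if does (j ≟ k) then Sign.- else Sign.+

-- A column whose first nonzero entry is -1, or one that is smaller than its left neighbour.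
data Defect (n : ℕ) : Set where
  negative : Fin n → Defect n
  inverted : Fin n → Defect n

shift : ∀ {n} → Defect n → Defect (suc n)
shift (negative j) = negative (suc j)
shift (inverted j) = inverted (suc j)

-- The rows above the new one stay as they are: a negated column is zero there, and two swapped
-- columns agree there. Only the new row changes, and it decreases.
repair : Defect 12 → Move
repair (negative j) = move Perm.id plus Perm.id (minusAt j)
repair (inverted j) = move Perm.id plus (transpose (Fin.pred j) j) plus

_≟ₜ_ : (x y : Trit) → Dec (x ≡ y)
_≟ₜ_ = tri⇒dec≈ ≺-compare

columns : List Row → Vec (List Trit) 12
columns p = tabulate λ j → List.map (λ u → lookup u j) p

-- For each column, whether it is zero, and whether it equals the column on its left.
columnStates : ∀ {n} → Vec (List Trit) n → Vec (Bool × Bool) n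
columnStates cs = go nothing cs
  where
  isZero : List Trit → Bool
  isZero = List.foldr (λ x b → does (x ≟ₜ nil) ∧ b) true
  go : ∀ {n} → Maybe (List Trit) → Vec (List Trit) n → Vec (Bool × Bool) n
  go _        []       = []
  go nothing  (c ∷ cs) = (isZero c , false) ∷ go (just c) cs
  go (just d) (c ∷ cs) = (isZero c , does (List.≡-dec _≟ₜ_ c d)) ∷ go (just c) cs

-- The `Trit` argument is the entry to the left. Its initial value is never compared, because
-- `columnStates` does not mark the first column as equal to a left neighbour.
defect : ∀ {n} → Vec (Bool × Bool) n → Trit → Vec Trit n → Maybe (Defect n)
defect []                    _ []         = nothing
defect ((true , _)  ∷ ss)    y (neg ∷ xs) = just (negative zero)
defect ((_ , false) ∷ ss)    y (x ∷ xs)   = Maybe.map shift (defect ss x xs)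
defect ((_ , true)  ∷ ss)    y (x ∷ xs) with ≺-compare x y
... | tri< _ _ _ = just (inverted zero)
... | _          = Maybe.map shift (defect ss x xs)

-- A missing value gets the last position. This is harmless, since `toPermutation` checks both
-- inverse laws.
indexOf : ∀ {n} → Vec (Fin 12) (suc n) → Fin 12 → Fin (suc n)
indexOf (x ∷ [])     i = zero
indexOf (x ∷ y ∷ ys) i = if does (x ≟ i) then zero else suc (indexOf (y ∷ ys) i)

toPermutation : Vec (Fin 12) 12 → Maybe (Permutation′ 12)
toPermutation xs = check (tabulate (indexOf xs))
  where
  check : Vec (Fin 12) 12 → Maybe (Permutation′ 12)
  check ys with Fin.all? (λ i → lookup xs (lookup ys i) ≟ i) | Fin.all? (λ i → lookup ys (lookup xs i) ≟ i)
  ... | yes l | yes r = just (permutation (lookup xs) (lookup ys) l r)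
  ... | _     | _     = nothing

-- In a recorded row order, k stands for row k and 12 + k for its negative.
signedIndex : ℕ → Fin 12 × Sign
signedIndex k = k mod 12 , (if k <ᵇ 12 then Sign.+ else Sign.-)

fill : ∀ {A : Set} n → A → List A → Vec A n
fill zero    d xs       = []
fill (suc n) d []       = d ∷ fill n d []
fill (suc n) d (x ∷ xs) = x ∷ fill n d xs

-- A recorded order names only the rows that decide the comparison; the others follow in their
-- natural order with sign `Sign.+`.
completed : List (Fin 12 × Sign) → Vec (Fin 12 × Sign) 12
completed rs = fill 12 (zero , Sign.+) (rs ++ List.map (_, Sign.+) (filterᵇ unused (List.allFin 12)))
  where
  unused : Fin 12 → Bool
  unused i = List.foldr (λ r b → not (does (proj₁ r ≟ i)) ∧ b) true rs

-- Base 3, so that comparing codes compares columns lexicographically.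
code : ℕ → List Trit → ℕ
code a []         = a
code a (pos ∷ xs) = code (3 ℕ.* a) xs
code a (neg ∷ xs) = code (3 ℕ.* a ℕ.+ 1) xs
code a (nil ∷ xs) = code (3 ℕ.* a ℕ.+ 2) xs

insert : ∀ {A : Set} {n} → ℕ × A → Vec (ℕ × A) n → Vec (ℕ × A) (suc n)
insert kx       []             = kx ∷ []
insert (k , x) ((l , y) ∷ ys) = if k <ᵇ l then (k , x) ∷ (l , y) ∷ ys else (l , y) ∷ insert (k , x) ys

sort : ∀ {A : Set} {n} → Vec (ℕ × A) n → Vec (ℕ × A) n
sort []       = []
sort (x ∷ xs) = insert x (sort xs)

-- The best column move for a fixed signed row order: each column takes the sign with the smaller
-- code, and then the columns are sorted by code.
sortedColumns : List Row → List (Fin 12 × Sign) → Vec (Fin 12 × Sign) 12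
sortedColumns p rs = Vec.map proj₂ (sort (tabulate λ j → key j (List.map (entry j) rs)))
  where
  entry : Fin 12 → Fin 12 × Sign → Trit
  entry j (i , s) = s • Maybe.maybe (λ u → lookup u j) nil (p ‼ toℕ i)
  least : Fin 12 → ℕ → ℕ → ℕ × Fin 12 × Sign
  least j a b = if b <ᵇ a then (b , j , Sign.-) else (a , j , Sign.+)
  key : Fin 12 → List Trit → ℕ × Fin 12 × Sign
  key j c = least j (code 0 c) (code 0 (List.map (Sign.- •_) c))

rearrangement : List Row → List ℕ → Maybe Move
rearrangement p ks = build (completed rs) (sortedColumns p rs)
  where
  rs = List.map signedIndex ks
  build : Vec (Fin 12 × Sign) 12 → Vec (Fin 12 × Sign) 12 → Maybe Move
  build rs cs with toPermutation (Vec.map proj₁ rs) | toPermutation (Vec.map proj₁ cs)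
  ... | just ρ | just τ = just (move ρ (lookup (Vec.map proj₂ rs)) τ (lookup (Vec.map proj₂ cs)))
  ... | _      | _      = nothing

-- Only the choices that are costly to find are stored: row orders for `cut`, representatives for
-- `leaf`. Candidates, defects and column orders are recomputed by the check.
data Tree : Set where
  cut  : List ℕ → Tree
  leaf : Fin 8 → Tree
  node : List Tree → Tree

tooFew : ℕ → List Row → Bool
tooFew zero    _       = false
tooFew (suc n) []      = true
tooFew (suc n) (_ ∷ C) = tooFew n C

tooFew-tail : ∀ n v C → T (tooFew n (v ∷ C)) → T (tooFew n C)
tooFew-tail (suc zero)    v []      ()
tooFew-tail (suc zero)    v (w ∷ C) ()
tooFew-tail (suc (suc n)) v []      few = _
tooFew-tail (suc (suc n)) v (w ∷ C) few = tooFew-tail (suc n) w C few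

tooFew-⊆ : ∀ {q C} → q ⊆ C → ¬ T (tooFew (length q) C)
tooFew-⊆ {q} {v ∷ C} (_ ∷ʳ q⊆C) few = tooFew-⊆ q⊆C (tooFew-tail (length q) v C few)
tooFew-⊆ (refl ∷ q⊆C) few = tooFew-⊆ q⊆C few

filterᵇ-⊆ : ∀ {A : Set} (f : A → Bool) {q C} → All (T ∘ f) q → q ⊆ C → q ⊆ filterᵇ f C
filterᵇ-⊆ f fq          []                      = []
filterᵇ-⊆ f fq          (_∷ʳ_ y q⊆C) with f y
... | true  = y ∷ʳ filterᵇ-⊆ f fq q⊆C
... | false = filterᵇ-⊆ f fq q⊆C
filterᵇ-⊆ f (fx ∷ fq) (_∷_ {x = x} refl q⊆C) with f x
... | true  = refl ∷ filterᵇ-⊆ f fq q⊆C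

-- In search p n st C ts, n + 1 rows are still missing, st describes the columns of p, and ts has one
-- subtree for each row of C that is neither defective nor leaves too few candidates.
mutual
  search : List Row → ℕ → Vec (Bool × Bool) 12 → List Row → List Tree → Bool
  search p n st []      ts = true
  search p n st (v ∷ C) ts = visit p n st v C ts (defect st nil v) (filterᵇ (orthogonal v) C)

  visit : List Row → ℕ → Vec (Bool × Bool) 12 → Row → List Row → List Tree → Maybe (Defect 12) → List Row → Bool
  -- The effect of `repair` is certified by evaluating `improves` on each occasion.
  visit p n st v C ts (just d) C′ = improves (repair d) (p ++ v ∷ []) ∧ search p n st C ts
  visit p n st v C ts nothing  C′ with tooFew n C′
  visit p n st v C ts       nothing C′ | true  = search p n st C ts
  -- A missing subtree makes the check fail.
  visit p n st v C []       nothing C′ | false = false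
  visit p n st v C (t ∷ ts) nothing C′ | false = searchTree (p ++ v ∷ []) n C′ t ∧ search p n st C ts

  searchTree : List Row → ℕ → List Row → Tree → Bool
  searchTree p n       C (cut ks)  = Maybe.maybe (λ g → improves g p) false (rearrangement p ks)
  searchTree p zero    C (leaf a)  = does (List.≡-dec (Vec.≡-dec _≟ₜ_) p (toList (table a)))
  searchTree p (suc n) C (node ts) = search p n (columnStates (columns p)) C ts
  searchTree p _       C _         = false

-- Soundness of the search

module Soundness (M : Vec Row 12) (Goal : Set)
  -- `improve` will be the induction hypothesis on smaller matrices, `found` the case of a
  -- representative.
  (improve : ∀ g → act g M <ₘ M → Goal)
  (found : ∀ a → M ≡ table a → Goal) where

  by-improvement : ∀ g p {q} → toList M ≡ p ++ q → T (improves g p) → Goal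
  by-improvement g p eq ok = improve g (improves-sound g M p eq ok)

  by-rearrangement : ∀ g p {q} → toList M ≡ p ++ q → T (Maybe.maybe (λ g → improves g p) false g) → Goal
  by-rearrangement (just g) p eq ok = by-improvement g p eq ok

  snoc : ∀ p {v : Row} {q} → toList M ≡ p ++ v ∷ q → toList M ≡ (p ++ v ∷ []) ++ q
  snoc p eq = trans eq (sym (List.++-assoc p _ _))

  mutual
    -- `q` stands for the unknown remaining rows. The proof of `q ⊆ v ∷ C` decides the case: either
    -- `v` is skipped and `q` embeds in `C`, or `v` is the next row and the branch at `v` applies.
    search-sound : ∀ p n st C ts {q} → T (search p n st C ts) →
                   toList M ≡ p ++ q → length q ≡ suc n → AllPairs Orthogonal q → q ⊆ C → Goal
    search-sound p n st []      ts ok eq ()  orth []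
    search-sound p n st (v ∷ C) ts ok eq len orth q⊆C =
      visit-sound p n st v C ts (defect st nil v) ok eq len orth q⊆C

    visit-sound : ∀ p n st v C ts d {q} → T (visit p n st v C ts d (filterᵇ (orthogonal v) C)) →
                  toList M ≡ p ++ q → length q ≡ suc n → AllPairs Orthogonal q → q ⊆ v ∷ C → Goal
    visit-sound p n st v C ts (just d) ok eq len orth q⊆C
      with Equivalence.to (T-∧ {improves (repair d) (p ++ v ∷ [])}) ok | q⊆C
    ... | _     , rest | _ ∷ʳ q⊆C′ = search-sound p n st C ts rest eq len orth q⊆C′
    ... | first , _    | refl ∷ _  = by-improvement (repair d) (p ++ v ∷ []) (snoc p eq) first
    visit-sound p n st v C ts nothing ok eq len orth q⊆C with tooFew n (filterᵇ (orthogonal v) C) in few | q⊆C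
    visit-sound p n st v C ts nothing ok eq len orth q⊆C | true | _ ∷ʳ q⊆C′ =
      search-sound p n st C ts ok eq len orth q⊆C′
    -- If `v` were the next row, the `n` rows after it would embed in the filtered candidates, of
    -- which there are fewer than `n`.
    visit-sound p n st v C ts nothing ok eq refl (v⊥ ∷ orth) q⊆C | true | refl ∷ q⊆C′ =
      contradiction (subst T (sym few) _) (tooFew-⊆ (filterᵇ-⊆ (orthogonal v) v⊥ q⊆C′))
    visit-sound p n st v C (t ∷ ts) nothing ok eq len orth q⊆C | false | q⊆C′
      with Equivalence.to (T-∧ {searchTree (p ++ v ∷ []) n (filterᵇ (orthogonal v) C) t}) ok | orth | q⊆C′
    ... | _     , rest | orth′      | _ ∷ʳ q⊆C″  = search-sound p n st C ts rest eq len orth′ q⊆C″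
    ... | first , _    | v⊥ ∷ orth′ | refl ∷ q⊆C″ =
      searchTree-sound (p ++ v ∷ []) n (filterᵇ (orthogonal v) C) t first (snoc p eq)
        (ℕ.suc-injective len) orth′ (filterᵇ-⊆ (orthogonal v) v⊥ q⊆C″)

    searchTree-sound : ∀ p n C t {q} → T (searchTree p n C t) →
                       toList M ≡ p ++ q → length q ≡ n → AllPairs Orthogonal q → q ⊆ C → Goal
    searchTree-sound p n C (cut ks) ok eq len orth q⊆C = by-rearrangement (rearrangement p ks) p eq ok
    searchTree-sound p zero C (leaf a) {[]} ok eq len orth q⊆C with List.≡-dec (Vec.≡-dec _≟ₜ_) p (toList (table a))
    -- No row is missing, so `p` is the whole of `M`.
    ... | yes p≡ = found a (trans (sym (Vec.cast-is-id refl M))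
      (Vec.toList-injective refl M (table a) (trans eq (trans (List.++-identityʳ p) p≡))))
    searchTree-sound p (suc n) C (node ts) ok eq len orth q⊆C =
      search-sound p n (columnStates (columns p)) C ts ok eq len orth q⊆C

  -- The candidates and the tree are variables and success is an equation, which keeps the
  -- evaluation of the search apart from its use.
  search-from-empty : ∀ n C ts → search [] n (columnStates (columns [])) C ts ≡ true →
                    length (toList M) ≡ suc n → AllPairs Orthogonal (toList M) → toList M ⊆ C → Goal
  search-from-empty n C ts ok = search-sound [] n (columnStates (columns [])) C ts (subst T (sym ok) _) refl

-- The search tree and its evaluation

tree : List Tree
tree =
  -- The only first row without a defect is `111111000000`.
  node (
    -- Second row `111222000000`, meeting the first in six columns: representatives 0 to 2.
    node (
      node (
        node (
          node (node (node (node [] ∷ []) ∷ []) ∷ node (node [] ∷ []) ∷ []) ∷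
          cut (1 ∷ 0 ∷ 3 ∷ 2 ∷ 4 ∷ []) ∷ cut (0 ∷ 1 ∷ 3 ∷ 2 ∷ 4 ∷ []) ∷
          cut (0 ∷ 1 ∷ 3 ∷ 2 ∷ 4 ∷ []) ∷
          node (
            node (
              cut (0 ∷ 1 ∷ 14 ∷ 15 ∷ 6 ∷ []) ∷ cut (0 ∷ 1 ∷ 14 ∷ 15 ∷ 6 ∷ []) ∷
              cut (0 ∷ 1 ∷ 14 ∷ 15 ∷ 6 ∷ []) ∷ cut (0 ∷ 1 ∷ 14 ∷ 15 ∷ 6 ∷ []) ∷
              node (
                node (
                  node (node (node (leaf (# 0) ∷ []) ∷ []) ∷ []) ∷
                  cut (0 ∷ 1 ∷ 2 ∷ 3 ∷ 4 ∷ 5 ∷ 7 ∷ 6 ∷ 8 ∷ []) ∷ []) ∷ []) ∷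
              node (node [] ∷ []) ∷ []) ∷
            cut (0 ∷ 1 ∷ 14 ∷ 15 ∷ 5 ∷ []) ∷ cut (0 ∷ 1 ∷ 14 ∷ 15 ∷ 5 ∷ []) ∷
            cut (0 ∷ 1 ∷ 14 ∷ 15 ∷ 5 ∷ []) ∷ cut (0 ∷ 1 ∷ 14 ∷ 15 ∷ 5 ∷ []) ∷
            node (cut (0 ∷ 1 ∷ 14 ∷ 15 ∷ 5 ∷ 6 ∷ []) ∷ []) ∷ []) ∷
          cut (0 ∷ 1 ∷ 14 ∷ 15 ∷ 4 ∷ []) ∷ cut (0 ∷ 1 ∷ 14 ∷ 15 ∷ 4 ∷ []) ∷
          cut (0 ∷ 1 ∷ 14 ∷ 15 ∷ 4 ∷ []) ∷ cut (0 ∷ 1 ∷ 14 ∷ 15 ∷ 4 ∷ []) ∷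
          cut (0 ∷ 1 ∷ 14 ∷ 15 ∷ 4 ∷ []) ∷ cut (0 ∷ 13 ∷ 2 ∷ 15 ∷ 4 ∷ []) ∷ []) ∷
        node (
          node (node [] ∷ node (node [] ∷ []) ∷ []) ∷
          node (
            node (
              node (node [] ∷ []) ∷ cut (1 ∷ 0 ∷ 3 ∷ 2 ∷ 5 ∷ 4 ∷ 6 ∷ []) ∷
              node (node (node (node (node (leaf (# 1) ∷ []) ∷ []) ∷ []) ∷ []) ∷ []) ∷ []) ∷
            node (cut (0 ∷ 1 ∷ 14 ∷ 15 ∷ 5 ∷ 6 ∷ []) ∷ []) ∷ node [] ∷ node (node [] ∷ []) ∷ []) ∷
          cut (1 ∷ 0 ∷ 3 ∷ 2 ∷ 4 ∷ []) ∷ cut (0 ∷ 1 ∷ 3 ∷ 2 ∷ 4 ∷ []) ∷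
          cut (0 ∷ 1 ∷ 3 ∷ 2 ∷ 4 ∷ []) ∷
          node (
            node (
              cut (0 ∷ 1 ∷ 14 ∷ 15 ∷ 6 ∷ []) ∷ cut (0 ∷ 1 ∷ 14 ∷ 15 ∷ 6 ∷ []) ∷
              cut (0 ∷ 1 ∷ 14 ∷ 15 ∷ 6 ∷ []) ∷ cut (0 ∷ 1 ∷ 14 ∷ 15 ∷ 6 ∷ []) ∷ []) ∷
            cut (0 ∷ 1 ∷ 14 ∷ 15 ∷ 5 ∷ []) ∷ cut (0 ∷ 1 ∷ 14 ∷ 15 ∷ 5 ∷ []) ∷
            cut (0 ∷ 1 ∷ 14 ∷ 15 ∷ 5 ∷ []) ∷ cut (0 ∷ 1 ∷ 14 ∷ 15 ∷ 5 ∷ []) ∷ []) ∷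
          cut (0 ∷ 1 ∷ 14 ∷ 15 ∷ 4 ∷ []) ∷ cut (0 ∷ 1 ∷ 14 ∷ 15 ∷ 4 ∷ []) ∷
          cut (0 ∷ 1 ∷ 14 ∷ 15 ∷ 4 ∷ []) ∷ cut (0 ∷ 1 ∷ 14 ∷ 15 ∷ 4 ∷ []) ∷
          cut (0 ∷ 1 ∷ 14 ∷ 15 ∷ 4 ∷ []) ∷ cut (0 ∷ 13 ∷ 2 ∷ 15 ∷ 4 ∷ []) ∷
          cut (0 ∷ 13 ∷ 2 ∷ 15 ∷ 4 ∷ []) ∷ []) ∷
        node (
          node (node (node (node [] ∷ []) ∷ []) ∷ []) ∷
          node (
            node (
              node (
                node (node [] ∷ []) ∷ cut (0 ∷ 13 ∷ 2 ∷ 17 ∷ 4 ∷ 15 ∷ 18 ∷ 7 ∷ []) ∷ []) ∷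
              node (node [] ∷ []) ∷ []) ∷
            node (node (node [] ∷ []) ∷ []) ∷ []) ∷
          cut (1 ∷ 0 ∷ 3 ∷ 2 ∷ 4 ∷ []) ∷
          node (
            node (
              cut (0 ∷ 1 ∷ 15 ∷ 14 ∷ 6 ∷ []) ∷ cut (0 ∷ 1 ∷ 15 ∷ 14 ∷ 6 ∷ []) ∷
              node (node (node (node (node (leaf (# 2) ∷ []) ∷ []) ∷ []) ∷ []) ∷ []) ∷ []) ∷
            cut (0 ∷ 1 ∷ 15 ∷ 14 ∷ 5 ∷ []) ∷ []) ∷
          node (cut (0 ∷ 1 ∷ 15 ∷ 14 ∷ 5 ∷ []) ∷ []) ∷ cut (0 ∷ 1 ∷ 15 ∷ 14 ∷ 4 ∷ []) ∷
          cut (0 ∷ 1 ∷ 15 ∷ 14 ∷ 4 ∷ []) ∷ cut (0 ∷ 1 ∷ 15 ∷ 14 ∷ 4 ∷ []) ∷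
          cut (0 ∷ 1 ∷ 15 ∷ 14 ∷ 4 ∷ []) ∷ []) ∷
        cut (0 ∷ 1 ∷ 14 ∷ 15 ∷ []) ∷
        node (
          cut (0 ∷ 13 ∷ 2 ∷ 16 ∷ []) ∷
          node (cut (0 ∷ 1 ∷ 4 ∷ 5 ∷ []) ∷ cut (0 ∷ 13 ∷ 4 ∷ 17 ∷ []) ∷ []) ∷
          cut (1 ∷ 0 ∷ 2 ∷ 3 ∷ 4 ∷ []) ∷ node [] ∷ cut (0 ∷ 13 ∷ 2 ∷ 4 ∷ []) ∷
          cut (0 ∷ 1 ∷ 14 ∷ 15 ∷ 4 ∷ []) ∷ cut (0 ∷ 1 ∷ 14 ∷ 15 ∷ 4 ∷ []) ∷
          cut (0 ∷ 1 ∷ 14 ∷ 15 ∷ 4 ∷ []) ∷ node [] ∷ node (node [] ∷ []) ∷ []) ∷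
        node (
          cut (0 ∷ 1 ∷ 3 ∷ 4 ∷ []) ∷ cut (0 ∷ 1 ∷ 3 ∷ 4 ∷ []) ∷ cut (0 ∷ 1 ∷ 3 ∷ 4 ∷ []) ∷
          node (cut (0 ∷ 1 ∷ 4 ∷ 5 ∷ []) ∷ []) ∷ node [] ∷
          node (node [] ∷ node [] ∷ node [] ∷ []) ∷ cut (0 ∷ 13 ∷ 2 ∷ 3 ∷ 4 ∷ []) ∷ []) ∷
        cut (0 ∷ 13 ∷ 2 ∷ 15 ∷ []) ∷ node (node (node [] ∷ []) ∷ []) ∷
        node (
          cut (0 ∷ 1 ∷ 3 ∷ 4 ∷ []) ∷ cut (0 ∷ 1 ∷ 3 ∷ 4 ∷ []) ∷ cut (0 ∷ 1 ∷ 14 ∷ 4 ∷ []) ∷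
          cut (0 ∷ 1 ∷ 15 ∷ 16 ∷ []) ∷ cut (0 ∷ 1 ∷ 14 ∷ 4 ∷ []) ∷ cut (1 ∷ 0 ∷ 15 ∷ 16 ∷ []) ∷
          node (node [] ∷ []) ∷ cut (0 ∷ 13 ∷ 2 ∷ 4 ∷ []) ∷ cut (0 ∷ 13 ∷ 3 ∷ 16 ∷ []) ∷ []) ∷
        cut (0 ∷ 1 ∷ 3 ∷ 2 ∷ []) ∷ cut (0 ∷ 1 ∷ 3 ∷ 2 ∷ []) ∷ cut (1 ∷ 0 ∷ 2 ∷ 3 ∷ []) ∷
        node (
          node (
            cut (0 ∷ 1 ∷ 14 ∷ 5 ∷ []) ∷ cut (0 ∷ 1 ∷ 14 ∷ 5 ∷ []) ∷ cut (0 ∷ 1 ∷ 14 ∷ 5 ∷ []) ∷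
            cut (0 ∷ 1 ∷ 14 ∷ 5 ∷ []) ∷ node (cut (3 ∷ 4 ∷ 5 ∷ 6 ∷ []) ∷ []) ∷ []) ∷
          node (
            cut (0 ∷ 1 ∷ 14 ∷ 5 ∷ []) ∷ cut (0 ∷ 1 ∷ 14 ∷ 5 ∷ []) ∷ cut (0 ∷ 1 ∷ 14 ∷ 5 ∷ []) ∷
            cut (0 ∷ 1 ∷ 14 ∷ 5 ∷ []) ∷ []) ∷
          cut (0 ∷ 1 ∷ 14 ∷ 4 ∷ []) ∷ cut (0 ∷ 1 ∷ 14 ∷ 4 ∷ []) ∷ cut (0 ∷ 1 ∷ 14 ∷ 4 ∷ []) ∷
          cut (0 ∷ 1 ∷ 14 ∷ 4 ∷ []) ∷ cut (0 ∷ 1 ∷ 14 ∷ 4 ∷ []) ∷ cut (0 ∷ 1 ∷ 14 ∷ 4 ∷ []) ∷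
          cut (0 ∷ 1 ∷ 14 ∷ 4 ∷ []) ∷ node (cut (0 ∷ 1 ∷ 14 ∷ 4 ∷ 5 ∷ []) ∷ []) ∷ node [] ∷
          cut (0 ∷ 13 ∷ 2 ∷ 4 ∷ []) ∷ node [] ∷ node [] ∷ cut (1 ∷ 0 ∷ 2 ∷ 3 ∷ 4 ∷ []) ∷ []) ∷
        cut (0 ∷ 1 ∷ 14 ∷ 3 ∷ []) ∷ cut (0 ∷ 1 ∷ 14 ∷ 3 ∷ []) ∷ cut (0 ∷ 1 ∷ 14 ∷ 3 ∷ []) ∷
        cut (0 ∷ 1 ∷ 14 ∷ 3 ∷ []) ∷ cut (0 ∷ 1 ∷ 14 ∷ 3 ∷ []) ∷ cut (0 ∷ 1 ∷ 14 ∷ 3 ∷ []) ∷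
        cut (0 ∷ 1 ∷ 14 ∷ 3 ∷ []) ∷ cut (0 ∷ 1 ∷ 14 ∷ 3 ∷ []) ∷ cut (0 ∷ 13 ∷ 2 ∷ 3 ∷ []) ∷
        cut (0 ∷ 13 ∷ 2 ∷ 3 ∷ []) ∷ cut (0 ∷ 1 ∷ 14 ∷ 3 ∷ []) ∷ []) ∷
      node (
        node (
          cut (0 ∷ 1 ∷ 4 ∷ []) ∷ cut (2 ∷ 3 ∷ 4 ∷ []) ∷ cut (0 ∷ 1 ∷ 4 ∷ []) ∷
          cut (2 ∷ 3 ∷ 4 ∷ []) ∷ node (node [] ∷ []) ∷ []) ∷
        node (
          node (node [] ∷ cut (0 ∷ 1 ∷ 3 ∷ 2 ∷ 4 ∷ 5 ∷ []) ∷ []) ∷ cut (0 ∷ 1 ∷ 4 ∷ []) ∷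
          node (node [] ∷ []) ∷ cut (0 ∷ 1 ∷ 4 ∷ []) ∷ cut (0 ∷ 1 ∷ 14 ∷ 15 ∷ 4 ∷ []) ∷ node [] ∷
          cut (0 ∷ 1 ∷ 3 ∷ 2 ∷ 4 ∷ []) ∷ []) ∷
        cut (0 ∷ 1 ∷ 3 ∷ []) ∷
        node (
          cut (3 ∷ 4 ∷ 2 ∷ []) ∷ cut (0 ∷ 1 ∷ 3 ∷ 4 ∷ []) ∷ cut (0 ∷ 1 ∷ 4 ∷ []) ∷
          cut (0 ∷ 1 ∷ 4 ∷ []) ∷ node (cut (4 ∷ 5 ∷ 2 ∷ []) ∷ []) ∷ cut (0 ∷ 1 ∷ 3 ∷ 2 ∷ 16 ∷ []) ∷
          node (cut (4 ∷ 5 ∷ 2 ∷ []) ∷ []) ∷ cut (0 ∷ 1 ∷ 14 ∷ 4 ∷ 3 ∷ []) ∷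
          node (cut (0 ∷ 13 ∷ 4 ∷ 5 ∷ []) ∷ []) ∷ cut (0 ∷ 1 ∷ 2 ∷ 3 ∷ 16 ∷ []) ∷ node [] ∷
          cut (0 ∷ 1 ∷ 2 ∷ 3 ∷ 16 ∷ []) ∷ []) ∷
        cut (0 ∷ 1 ∷ 3 ∷ []) ∷ cut (0 ∷ 1 ∷ 14 ∷ 3 ∷ []) ∷ node [] ∷
        node (cut (0 ∷ 13 ∷ 3 ∷ 4 ∷ []) ∷ cut (0 ∷ 13 ∷ 3 ∷ 4 ∷ []) ∷ []) ∷ []) ∷
      cut (0 ∷ 13 ∷ 2 ∷ []) ∷ node [] ∷ []) ∷
    -- Second row `112200110000`, meeting the first in four columns: representatives 3 to 7.
    node (
      node (
        cut (0 ∷ 3 ∷ []) ∷ cut (1 ∷ 3 ∷ []) ∷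
        node (
          cut (0 ∷ 4 ∷ []) ∷ cut (1 ∷ 4 ∷ []) ∷ cut (3 ∷ 4 ∷ []) ∷
          node (
            node (
              node (
                node (
                  node (node (node (leaf (# 3) ∷ []) ∷ []) ∷ []) ∷
                  cut (0 ∷ 1 ∷ 2 ∷ 4 ∷ 3 ∷ 5 ∷ 6 ∷ 19 ∷ 8 ∷ []) ∷ []) ∷
                node [] ∷ cut (0 ∷ 1 ∷ 2 ∷ 4 ∷ 3 ∷ 5 ∷ 6 ∷ 7 ∷ []) ∷ []) ∷
              cut (3 ∷ 4 ∷ 5 ∷ 0 ∷ 1 ∷ 2 ∷ 6 ∷ []) ∷ node [] ∷
              cut (0 ∷ 1 ∷ 2 ∷ 4 ∷ 3 ∷ 5 ∷ 6 ∷ []) ∷ []) ∷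
            node (
              cut (0 ∷ 13 ∷ 5 ∷ 3 ∷ 16 ∷ 6 ∷ []) ∷ node [] ∷ cut (0 ∷ 1 ∷ 2 ∷ 4 ∷ 3 ∷ 5 ∷ 6 ∷ []) ∷ []) ∷
            node (node [] ∷ cut (0 ∷ 1 ∷ 2 ∷ 4 ∷ 3 ∷ 17 ∷ 6 ∷ []) ∷ []) ∷ node [] ∷
            cut (0 ∷ 1 ∷ 2 ∷ 4 ∷ 3 ∷ 5 ∷ []) ∷ []) ∷
          node (
            node (
              node (
                node (node (node (node (leaf (# 4) ∷ []) ∷ []) ∷ []) ∷ []) ∷
                cut (0 ∷ 1 ∷ 2 ∷ 15 ∷ 17 ∷ 16 ∷ 18 ∷ 7 ∷ []) ∷ []) ∷
              node (node [] ∷ []) ∷ cut (0 ∷ 1 ∷ 2 ∷ 15 ∷ 17 ∷ 16 ∷ 6 ∷ []) ∷ []) ∷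
            node (node (node [] ∷ []) ∷ node [] ∷ []) ∷ node (node [] ∷ []) ∷ node [] ∷ []) ∷
          cut (0 ∷ 1 ∷ 2 ∷ 15 ∷ 16 ∷ []) ∷
          node (node (node [] ∷ []) ∷ node [] ∷ node (node [] ∷ []) ∷ []) ∷
          cut (1 ∷ 0 ∷ 2 ∷ 3 ∷ 4 ∷ []) ∷
          node (
            node (node (node [] ∷ node [] ∷ []) ∷ node [] ∷ node [] ∷ []) ∷
            node (node [] ∷ node [] ∷ []) ∷ node [] ∷ node [] ∷ []) ∷
          node (
            cut (0 ∷ 13 ∷ 4 ∷ 3 ∷ 5 ∷ []) ∷ cut (0 ∷ 13 ∷ 4 ∷ 3 ∷ 5 ∷ []) ∷
            cut (0 ∷ 13 ∷ 4 ∷ 3 ∷ 5 ∷ []) ∷ node [] ∷ node [] ∷ []) ∷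
          node [] ∷ cut (1 ∷ 0 ∷ 2 ∷ 3 ∷ 4 ∷ []) ∷
          node (
            node (node [] ∷ []) ∷ cut (0 ∷ 1 ∷ 2 ∷ 15 ∷ 16 ∷ 5 ∷ []) ∷ node [] ∷ node [] ∷ []) ∷
          node (
            node [] ∷ cut (1 ∷ 0 ∷ 2 ∷ 15 ∷ 16 ∷ 17 ∷ []) ∷ node [] ∷ node [] ∷ node [] ∷ []) ∷
          cut (0 ∷ 1 ∷ 2 ∷ 15 ∷ 4 ∷ []) ∷ node [] ∷ node [] ∷ []) ∷
        node (
          cut (0 ∷ 4 ∷ []) ∷ cut (1 ∷ 4 ∷ []) ∷ cut (0 ∷ 1 ∷ 2 ∷ 4 ∷ []) ∷ cut (3 ∷ 4 ∷ []) ∷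
          node (cut (1 ∷ 2 ∷ 0 ∷ 5 ∷ []) ∷ node (node [] ∷ []) ∷ node [] ∷ []) ∷
          cut (1 ∷ 0 ∷ 2 ∷ 15 ∷ 16 ∷ []) ∷
          node (cut (2 ∷ 5 ∷ []) ∷ node (cut (5 ∷ 6 ∷ []) ∷ []) ∷ []) ∷
          cut (0 ∷ 2 ∷ 1 ∷ 15 ∷ 16 ∷ []) ∷ cut (0 ∷ 2 ∷ 1 ∷ 15 ∷ 16 ∷ []) ∷
          cut (1 ∷ 0 ∷ 2 ∷ 15 ∷ 16 ∷ []) ∷ cut (2 ∷ 4 ∷ []) ∷ cut (0 ∷ 2 ∷ 1 ∷ 4 ∷ []) ∷
          cut (1 ∷ 2 ∷ 0 ∷ 4 ∷ []) ∷ node (node [] ∷ node [] ∷ []) ∷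
          cut (1 ∷ 0 ∷ 2 ∷ 15 ∷ 16 ∷ []) ∷
          node (cut (4 ∷ 5 ∷ []) ∷ node (node [] ∷ []) ∷ node [] ∷ []) ∷ node (node [] ∷ []) ∷
          cut (0 ∷ 2 ∷ 1 ∷ 15 ∷ 4 ∷ []) ∷ cut (1 ∷ 0 ∷ 2 ∷ 15 ∷ 16 ∷ []) ∷
          node (cut (4 ∷ 5 ∷ []) ∷ []) ∷ []) ∷
        cut (0 ∷ 1 ∷ 2 ∷ 15 ∷ []) ∷ cut (2 ∷ 3 ∷ []) ∷ cut (0 ∷ 2 ∷ 1 ∷ 3 ∷ []) ∷
        cut (1 ∷ 0 ∷ 2 ∷ 3 ∷ []) ∷
        node (
          cut (3 ∷ 4 ∷ []) ∷
          node (
            cut (4 ∷ 5 ∷ []) ∷ cut (0 ∷ 13 ∷ 4 ∷ 5 ∷ []) ∷ cut (0 ∷ 13 ∷ 4 ∷ 5 ∷ []) ∷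
            node (cut (0 ∷ 14 ∷ 16 ∷ 6 ∷ []) ∷ cut (0 ∷ 14 ∷ 16 ∷ 6 ∷ []) ∷ []) ∷
            cut (0 ∷ 14 ∷ 16 ∷ 5 ∷ []) ∷ []) ∷
          node [] ∷ node [] ∷ cut (1 ∷ 0 ∷ 2 ∷ 3 ∷ 4 ∷ []) ∷
          node (cut (0 ∷ 2 ∷ 1 ∷ 3 ∷ 5 ∷ []) ∷ cut (0 ∷ 2 ∷ 1 ∷ 3 ∷ 5 ∷ []) ∷ []) ∷ []) ∷
        node (
          cut (3 ∷ 4 ∷ []) ∷ cut (0 ∷ 13 ∷ 3 ∷ 4 ∷ []) ∷ cut (0 ∷ 13 ∷ 3 ∷ 4 ∷ []) ∷
          cut (0 ∷ 13 ∷ 3 ∷ 4 ∷ []) ∷ cut (0 ∷ 14 ∷ 15 ∷ 4 ∷ []) ∷ cut (0 ∷ 14 ∷ 15 ∷ 4 ∷ []) ∷ []) ∷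
        node [] ∷
        node (
          cut (3 ∷ 4 ∷ []) ∷ node [] ∷ node [] ∷ node [] ∷ node (node [] ∷ []) ∷
          cut (0 ∷ 1 ∷ 2 ∷ 15 ∷ 4 ∷ []) ∷ []) ∷
        cut (1 ∷ 0 ∷ 2 ∷ 3 ∷ []) ∷
        node (cut (3 ∷ 4 ∷ []) ∷ node (node [] ∷ []) ∷ cut (0 ∷ 1 ∷ 2 ∷ 15 ∷ 4 ∷ []) ∷ []) ∷
        node (
          cut (3 ∷ 4 ∷ []) ∷ node [] ∷ cut (1 ∷ 0 ∷ 2 ∷ 15 ∷ 16 ∷ []) ∷ node [] ∷
          cut (0 ∷ 2 ∷ 1 ∷ 15 ∷ 4 ∷ []) ∷ cut (0 ∷ 2 ∷ 1 ∷ 15 ∷ 4 ∷ []) ∷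
          cut (1 ∷ 0 ∷ 2 ∷ 15 ∷ 16 ∷ []) ∷ []) ∷
        cut (0 ∷ 2 ∷ 1 ∷ 3 ∷ []) ∷ cut (0 ∷ 2 ∷ 1 ∷ 3 ∷ []) ∷ []) ∷
      cut (0 ∷ 2 ∷ []) ∷ cut (1 ∷ 2 ∷ []) ∷
      node (
        cut (0 ∷ 3 ∷ []) ∷ cut (1 ∷ 3 ∷ []) ∷ cut (2 ∷ 3 ∷ []) ∷
        node (
          cut (2 ∷ 3 ∷ 4 ∷ []) ∷ cut (0 ∷ 2 ∷ 4 ∷ []) ∷ cut (1 ∷ 3 ∷ 4 ∷ []) ∷
          cut (0 ∷ 3 ∷ 4 ∷ []) ∷ cut (1 ∷ 2 ∷ 4 ∷ []) ∷ cut (0 ∷ 15 ∷ 4 ∷ []) ∷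
          cut (1 ∷ 14 ∷ 4 ∷ []) ∷ cut (0 ∷ 14 ∷ 4 ∷ []) ∷ cut (1 ∷ 15 ∷ 4 ∷ []) ∷
          cut (0 ∷ 13 ∷ 4 ∷ []) ∷ cut (2 ∷ 15 ∷ 4 ∷ []) ∷ []) ∷
        node (
          cut (2 ∷ 3 ∷ 4 ∷ []) ∷ cut (0 ∷ 2 ∷ 4 ∷ []) ∷ cut (1 ∷ 3 ∷ 4 ∷ []) ∷
          node (
            node (
              cut (0 ∷ 15 ∷ 6 ∷ []) ∷ cut (1 ∷ 14 ∷ 6 ∷ []) ∷ cut (4 ∷ 17 ∷ 18 ∷ []) ∷ []) ∷
            cut (0 ∷ 15 ∷ 5 ∷ []) ∷ cut (1 ∷ 14 ∷ 5 ∷ []) ∷ node [] ∷ []) ∷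
          node (cut (0 ∷ 15 ∷ 5 ∷ []) ∷ cut (1 ∷ 14 ∷ 5 ∷ []) ∷ node [] ∷ []) ∷
          cut (0 ∷ 15 ∷ 4 ∷ []) ∷ cut (1 ∷ 14 ∷ 4 ∷ []) ∷ cut (1 ∷ 0 ∷ 14 ∷ 15 ∷ 4 ∷ []) ∷
          cut (1 ∷ 0 ∷ 14 ∷ 15 ∷ 4 ∷ []) ∷ cut (0 ∷ 2 ∷ 1 ∷ 3 ∷ 4 ∷ []) ∷
          cut (0 ∷ 2 ∷ 1 ∷ 3 ∷ 4 ∷ []) ∷ []) ∷
        cut (0 ∷ 1 ∷ 14 ∷ 15 ∷ []) ∷
        node (cut (0 ∷ 13 ∷ 4 ∷ []) ∷ cut (2 ∷ 15 ∷ 16 ∷ []) ∷ node (node [] ∷ []) ∷ []) ∷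
        cut (1 ∷ 0 ∷ 2 ∷ 3 ∷ []) ∷
        node (
          cut (0 ∷ 13 ∷ 2 ∷ 16 ∷ []) ∷
          node (
            cut (0 ∷ 13 ∷ 2 ∷ 5 ∷ []) ∷ cut (3 ∷ 16 ∷ 5 ∷ []) ∷ cut (0 ∷ 13 ∷ 5 ∷ []) ∷ []) ∷
          cut (0 ∷ 13 ∷ 2 ∷ 4 ∷ []) ∷ cut (0 ∷ 1 ∷ 14 ∷ 15 ∷ 4 ∷ []) ∷ cut (0 ∷ 13 ∷ 4 ∷ []) ∷
          cut (2 ∷ 15 ∷ 16 ∷ []) ∷ []) ∷
        cut (0 ∷ 2 ∷ 3 ∷ []) ∷ cut (0 ∷ 13 ∷ 2 ∷ 15 ∷ []) ∷ cut (0 ∷ 2 ∷ 1 ∷ 3 ∷ []) ∷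
        cut (0 ∷ 2 ∷ 1 ∷ 3 ∷ []) ∷ cut (0 ∷ 2 ∷ 1 ∷ 3 ∷ []) ∷ cut (1 ∷ 0 ∷ 2 ∷ 3 ∷ []) ∷
        cut (0 ∷ 2 ∷ 1 ∷ 3 ∷ []) ∷ cut (1 ∷ 0 ∷ 2 ∷ 3 ∷ []) ∷ cut (1 ∷ 2 ∷ 3 ∷ []) ∷
        node (
          node (
            cut (1 ∷ 14 ∷ 5 ∷ []) ∷ cut (0 ∷ 14 ∷ 5 ∷ []) ∷ cut (0 ∷ 1 ∷ 14 ∷ 5 ∷ []) ∷ []) ∷
          cut (1 ∷ 0 ∷ 2 ∷ 3 ∷ 4 ∷ []) ∷ cut (0 ∷ 2 ∷ 1 ∷ 3 ∷ 4 ∷ []) ∷ cut (0 ∷ 1 ∷ 14 ∷ 4 ∷ []) ∷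
          cut (0 ∷ 1 ∷ 14 ∷ 4 ∷ []) ∷ cut (0 ∷ 1 ∷ 14 ∷ 4 ∷ []) ∷ cut (1 ∷ 14 ∷ 4 ∷ []) ∷
          cut (0 ∷ 14 ∷ 4 ∷ []) ∷ cut (0 ∷ 1 ∷ 14 ∷ 4 ∷ []) ∷ cut (0 ∷ 1 ∷ 14 ∷ 4 ∷ []) ∷
          node (cut (0 ∷ 13 ∷ 5 ∷ []) ∷ []) ∷ node [] ∷ cut (1 ∷ 0 ∷ 2 ∷ 3 ∷ 4 ∷ []) ∷
          node (cut (0 ∷ 13 ∷ 5 ∷ []) ∷ []) ∷ cut (0 ∷ 13 ∷ 4 ∷ []) ∷ []) ∷
        cut (0 ∷ 1 ∷ 14 ∷ 3 ∷ []) ∷ cut (0 ∷ 1 ∷ 14 ∷ 3 ∷ []) ∷ cut (0 ∷ 1 ∷ 14 ∷ 3 ∷ []) ∷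
        cut (0 ∷ 1 ∷ 14 ∷ 3 ∷ []) ∷ cut (1 ∷ 14 ∷ 3 ∷ []) ∷ cut (0 ∷ 14 ∷ 3 ∷ []) ∷
        cut (0 ∷ 1 ∷ 14 ∷ 3 ∷ []) ∷ cut (0 ∷ 1 ∷ 14 ∷ 3 ∷ []) ∷ cut (0 ∷ 1 ∷ 14 ∷ 3 ∷ []) ∷
        cut (0 ∷ 1 ∷ 14 ∷ 3 ∷ []) ∷ cut (0 ∷ 13 ∷ 3 ∷ []) ∷ cut (0 ∷ 13 ∷ 2 ∷ 3 ∷ []) ∷
        cut (0 ∷ 13 ∷ 2 ∷ 3 ∷ []) ∷ cut (0 ∷ 13 ∷ 2 ∷ 3 ∷ []) ∷ cut (0 ∷ 13 ∷ 2 ∷ 3 ∷ []) ∷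
        cut (0 ∷ 1 ∷ 14 ∷ 3 ∷ []) ∷ node [] ∷ node [] ∷ []) ∷
      node (
        cut (0 ∷ 3 ∷ []) ∷ cut (1 ∷ 3 ∷ []) ∷ cut (0 ∷ 1 ∷ 3 ∷ []) ∷ cut (2 ∷ 3 ∷ []) ∷
        cut (0 ∷ 2 ∷ 3 ∷ []) ∷ cut (1 ∷ 2 ∷ 3 ∷ []) ∷
        node (
          cut (2 ∷ 3 ∷ 4 ∷ []) ∷ cut (0 ∷ 2 ∷ 4 ∷ []) ∷ cut (1 ∷ 3 ∷ 4 ∷ []) ∷
          node (cut (4 ∷ 5 ∷ []) ∷ cut (0 ∷ 15 ∷ 5 ∷ []) ∷ cut (1 ∷ 14 ∷ 5 ∷ []) ∷ []) ∷
          cut (0 ∷ 15 ∷ 4 ∷ []) ∷ cut (1 ∷ 14 ∷ 4 ∷ []) ∷ cut (0 ∷ 1 ∷ 15 ∷ 14 ∷ 4 ∷ []) ∷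
          cut (0 ∷ 2 ∷ 1 ∷ 3 ∷ 4 ∷ []) ∷ []) ∷
        node (
          node (
            node (
              node (node (node (node (node (leaf (# 5) ∷ []) ∷ []) ∷ []) ∷ []) ∷ []) ∷ []) ∷ []) ∷
          node (
            node (
              node (node (node (node (node (leaf (# 6) ∷ []) ∷ []) ∷ []) ∷ []) ∷ []) ∷ []) ∷ []) ∷
          cut (2 ∷ 3 ∷ 1 ∷ 0 ∷ 4 ∷ []) ∷ node [] ∷ cut (0 ∷ 1 ∷ 15 ∷ 14 ∷ 4 ∷ []) ∷
          cut (0 ∷ 1 ∷ 15 ∷ 14 ∷ 4 ∷ []) ∷ cut (0 ∷ 1 ∷ 15 ∷ 14 ∷ 4 ∷ []) ∷
          cut (0 ∷ 1 ∷ 15 ∷ 14 ∷ 4 ∷ []) ∷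
          node (
            node (cut (4 ∷ 17 ∷ 6 ∷ []) ∷ []) ∷ cut (0 ∷ 1 ∷ 15 ∷ 14 ∷ 16 ∷ 5 ∷ []) ∷ []) ∷
          node (node [] ∷ []) ∷ []) ∷
        node [] ∷ cut (1 ∷ 0 ∷ 14 ∷ 15 ∷ []) ∷ cut (2 ∷ 3 ∷ 12 ∷ 13 ∷ []) ∷
        node (
          cut (0 ∷ 2 ∷ 1 ∷ 4 ∷ []) ∷
          node (
            node (
              node (node (node (node (node (leaf (# 7) ∷ []) ∷ []) ∷ []) ∷ []) ∷ []) ∷ []) ∷ []) ∷
          node [] ∷ cut (3 ∷ 0 ∷ 2 ∷ 4 ∷ 1 ∷ []) ∷ cut (1 ∷ 14 ∷ 0 ∷ 4 ∷ 3 ∷ []) ∷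
          cut (0 ∷ 14 ∷ 3 ∷ 16 ∷ []) ∷ cut (0 ∷ 14 ∷ 3 ∷ 16 ∷ 1 ∷ []) ∷
          cut (2 ∷ 3 ∷ 12 ∷ 13 ∷ 4 ∷ []) ∷ node (node [] ∷ []) ∷ node [] ∷ []) ∷
        cut (1 ∷ 0 ∷ 14 ∷ 15 ∷ []) ∷ cut (0 ∷ 2 ∷ 3 ∷ []) ∷ cut (0 ∷ 2 ∷ 1 ∷ 3 ∷ []) ∷
        cut (0 ∷ 2 ∷ 1 ∷ 3 ∷ []) ∷ cut (0 ∷ 2 ∷ 1 ∷ 3 ∷ []) ∷ cut (0 ∷ 2 ∷ 1 ∷ 3 ∷ []) ∷
        cut (0 ∷ 2 ∷ 1 ∷ 3 ∷ []) ∷ cut (0 ∷ 2 ∷ 1 ∷ 3 ∷ []) ∷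
        node (
          node [] ∷
          node (
            cut (0 ∷ 14 ∷ 5 ∷ 1 ∷ []) ∷ cut (1 ∷ 14 ∷ 5 ∷ []) ∷ cut (3 ∷ 16 ∷ 5 ∷ []) ∷ []) ∷
          node (cut (0 ∷ 14 ∷ 5 ∷ 1 ∷ []) ∷ []) ∷ cut (0 ∷ 14 ∷ 4 ∷ 1 ∷ []) ∷
          cut (1 ∷ 14 ∷ 4 ∷ []) ∷ node [] ∷ node [] ∷ node [] ∷ []) ∷
        cut (0 ∷ 2 ∷ 1 ∷ 3 ∷ []) ∷
        node (
          cut (3 ∷ 4 ∷ []) ∷ node (cut (0 ∷ 13 ∷ 5 ∷ 2 ∷ []) ∷ cut (1 ∷ 14 ∷ 5 ∷ []) ∷ []) ∷
          cut (0 ∷ 13 ∷ 4 ∷ 2 ∷ []) ∷ cut (0 ∷ 13 ∷ 4 ∷ 2 ∷ []) ∷ cut (0 ∷ 13 ∷ 4 ∷ 2 ∷ []) ∷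
          cut (0 ∷ 14 ∷ 4 ∷ 1 ∷ []) ∷ cut (1 ∷ 14 ∷ 4 ∷ []) ∷ []) ∷
        node (
          cut (0 ∷ 13 ∷ 4 ∷ 2 ∷ []) ∷ cut (1 ∷ 14 ∷ 4 ∷ []) ∷ cut (1 ∷ 0 ∷ 14 ∷ 4 ∷ []) ∷
          cut (1 ∷ 0 ∷ 14 ∷ 4 ∷ []) ∷ node [] ∷ []) ∷
        cut (0 ∷ 13 ∷ 3 ∷ 2 ∷ []) ∷ cut (0 ∷ 13 ∷ 3 ∷ 2 ∷ []) ∷ cut (0 ∷ 13 ∷ 3 ∷ 2 ∷ []) ∷
        cut (0 ∷ 13 ∷ 3 ∷ 2 ∷ []) ∷ cut (0 ∷ 2 ∷ 1 ∷ 3 ∷ []) ∷ cut (0 ∷ 2 ∷ 1 ∷ 3 ∷ []) ∷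
        cut (1 ∷ 14 ∷ 3 ∷ []) ∷ cut (1 ∷ 0 ∷ 14 ∷ 3 ∷ []) ∷ cut (1 ∷ 0 ∷ 14 ∷ 3 ∷ []) ∷
        cut (1 ∷ 0 ∷ 14 ∷ 3 ∷ []) ∷ cut (1 ∷ 0 ∷ 14 ∷ 3 ∷ []) ∷ cut (0 ∷ 2 ∷ 1 ∷ 3 ∷ []) ∷
        cut (0 ∷ 2 ∷ 1 ∷ 3 ∷ []) ∷ cut (0 ∷ 2 ∷ 1 ∷ 3 ∷ []) ∷ cut (0 ∷ 2 ∷ 1 ∷ 3 ∷ []) ∷ node [] ∷
        cut (1 ∷ 0 ∷ 14 ∷ 15 ∷ []) ∷ node [] ∷ []) ∷
      cut (0 ∷ 1 ∷ 14 ∷ []) ∷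
      node (
        cut (0 ∷ 2 ∷ 3 ∷ []) ∷ cut (1 ∷ 2 ∷ 3 ∷ []) ∷ cut (0 ∷ 13 ∷ 3 ∷ []) ∷
        node (cut (3 ∷ 4 ∷ []) ∷ node [] ∷ cut (0 ∷ 1 ∷ 14 ∷ 3 ∷ 4 ∷ []) ∷ []) ∷
        node (cut (3 ∷ 4 ∷ []) ∷ node [] ∷ []) ∷ cut (0 ∷ 1 ∷ 14 ∷ 3 ∷ []) ∷ []) ∷
      node (
        cut (0 ∷ 1 ∷ 3 ∷ []) ∷ cut (2 ∷ 3 ∷ []) ∷ cut (0 ∷ 2 ∷ 3 ∷ []) ∷
        node (
          cut (0 ∷ 13 ∷ 4 ∷ []) ∷ cut (2 ∷ 15 ∷ 4 ∷ []) ∷ cut (0 ∷ 13 ∷ 4 ∷ []) ∷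
          cut (2 ∷ 15 ∷ 4 ∷ []) ∷ cut (0 ∷ 13 ∷ 4 ∷ []) ∷ node (cut (4 ∷ 5 ∷ []) ∷ []) ∷ []) ∷
        node (
          cut (0 ∷ 13 ∷ 4 ∷ []) ∷ cut (2 ∷ 15 ∷ 4 ∷ []) ∷ cut (0 ∷ 13 ∷ 4 ∷ []) ∷ node [] ∷
          node [] ∷ []) ∷
        cut (0 ∷ 13 ∷ 3 ∷ []) ∷ cut (0 ∷ 2 ∷ 3 ∷ []) ∷
        node (
          cut (0 ∷ 2 ∷ 4 ∷ []) ∷ node [] ∷ cut (0 ∷ 13 ∷ 4 ∷ []) ∷ cut (0 ∷ 14 ∷ 4 ∷ []) ∷
          cut (1 ∷ 15 ∷ 16 ∷ []) ∷ node [] ∷ node [] ∷ cut (1 ∷ 15 ∷ 4 ∷ []) ∷ []) ∷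
        cut (2 ∷ 0 ∷ 3 ∷ 1 ∷ []) ∷
        node (
          cut (0 ∷ 14 ∷ 4 ∷ []) ∷ cut (0 ∷ 1 ∷ 14 ∷ 4 ∷ []) ∷ cut (2 ∷ 15 ∷ 4 ∷ []) ∷
          cut (0 ∷ 13 ∷ 4 ∷ []) ∷ node (cut (4 ∷ 5 ∷ []) ∷ []) ∷ cut (0 ∷ 1 ∷ 2 ∷ 3 ∷ 16 ∷ []) ∷ []) ∷
        cut (0 ∷ 13 ∷ 3 ∷ []) ∷ cut (0 ∷ 14 ∷ 3 ∷ []) ∷ cut (0 ∷ 1 ∷ 14 ∷ 3 ∷ []) ∷
        cut (0 ∷ 1 ∷ 14 ∷ 3 ∷ []) ∷ cut (0 ∷ 1 ∷ 14 ∷ 3 ∷ []) ∷ cut (0 ∷ 13 ∷ 3 ∷ []) ∷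
        cut (2 ∷ 3 ∷ 0 ∷ []) ∷ cut (2 ∷ 15 ∷ 0 ∷ []) ∷ node [] ∷
        node (cut (3 ∷ 4 ∷ []) ∷ cut (1 ∷ 12 ∷ 3 ∷ 4 ∷ []) ∷ []) ∷ node (cut (3 ∷ 4 ∷ []) ∷ []) ∷
        node (node [] ∷ []) ∷ cut (0 ∷ 1 ∷ 14 ∷ 3 ∷ []) ∷ []) ∷
      cut (1 ∷ 0 ∷ 2 ∷ []) ∷
      node (
        cut (2 ∷ 3 ∷ []) ∷ cut (0 ∷ 13 ∷ 3 ∷ []) ∷
        node (
          cut (2 ∷ 3 ∷ 4 ∷ []) ∷ cut (2 ∷ 3 ∷ 4 ∷ []) ∷ cut (2 ∷ 3 ∷ 4 ∷ []) ∷
          cut (0 ∷ 13 ∷ 4 ∷ []) ∷ cut (0 ∷ 13 ∷ 4 ∷ []) ∷ cut (0 ∷ 13 ∷ 4 ∷ []) ∷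
          cut (3 ∷ 16 ∷ 2 ∷ []) ∷ cut (2 ∷ 15 ∷ 4 ∷ []) ∷ cut (2 ∷ 4 ∷ 3 ∷ []) ∷
          cut (2 ∷ 15 ∷ 4 ∷ []) ∷ cut (0 ∷ 13 ∷ 4 ∷ []) ∷ cut (0 ∷ 13 ∷ 4 ∷ []) ∷ []) ∷
        cut (0 ∷ 13 ∷ 3 ∷ []) ∷ cut (0 ∷ 1 ∷ 14 ∷ 3 ∷ []) ∷ cut (0 ∷ 13 ∷ 3 ∷ []) ∷
        cut (0 ∷ 13 ∷ 3 ∷ []) ∷ cut (0 ∷ 13 ∷ 3 ∷ []) ∷ cut (0 ∷ 13 ∷ 3 ∷ []) ∷ node [] ∷ []) ∷
      cut (0 ∷ 13 ∷ 2 ∷ []) ∷ cut (0 ∷ 2 ∷ 1 ∷ []) ∷ cut (0 ∷ 2 ∷ 1 ∷ []) ∷ cut (1 ∷ 0 ∷ 2 ∷ []) ∷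
      cut (1 ∷ 0 ∷ 2 ∷ []) ∷
      node (
        cut (2 ∷ 3 ∷ []) ∷ cut (2 ∷ 3 ∷ 0 ∷ []) ∷ cut (2 ∷ 3 ∷ 1 ∷ []) ∷
        node (
          cut (0 ∷ 1 ∷ 4 ∷ []) ∷ cut (0 ∷ 1 ∷ 4 ∷ []) ∷ cut (0 ∷ 1 ∷ 4 ∷ []) ∷
          cut (0 ∷ 1 ∷ 4 ∷ []) ∷ cut (2 ∷ 3 ∷ 16 ∷ []) ∷ cut (2 ∷ 3 ∷ 16 ∷ []) ∷
          cut (2 ∷ 3 ∷ 16 ∷ []) ∷ cut (2 ∷ 3 ∷ 16 ∷ []) ∷ cut (0 ∷ 13 ∷ 4 ∷ []) ∷
          cut (0 ∷ 13 ∷ 4 ∷ []) ∷ cut (0 ∷ 13 ∷ 4 ∷ []) ∷ cut (0 ∷ 13 ∷ 4 ∷ []) ∷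
          cut (0 ∷ 13 ∷ 4 ∷ []) ∷ []) ∷
        cut (0 ∷ 1 ∷ 3 ∷ []) ∷ cut (0 ∷ 1 ∷ 3 ∷ []) ∷ cut (0 ∷ 1 ∷ 3 ∷ []) ∷ cut (0 ∷ 1 ∷ 3 ∷ []) ∷
        cut (0 ∷ 1 ∷ 3 ∷ []) ∷ cut (0 ∷ 1 ∷ 3 ∷ []) ∷ cut (0 ∷ 1 ∷ 3 ∷ []) ∷
        node (
          cut (2 ∷ 15 ∷ 4 ∷ []) ∷ cut (0 ∷ 13 ∷ 4 ∷ []) ∷ cut (0 ∷ 13 ∷ 4 ∷ []) ∷
          cut (0 ∷ 13 ∷ 4 ∷ []) ∷ cut (0 ∷ 13 ∷ 4 ∷ []) ∷ cut (0 ∷ 13 ∷ 4 ∷ []) ∷ []) ∷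
        node (cut (2 ∷ 3 ∷ 16 ∷ []) ∷ cut (0 ∷ 13 ∷ 4 ∷ []) ∷ []) ∷ cut (1 ∷ 0 ∷ 2 ∷ 3 ∷ []) ∷
        node (
          cut (3 ∷ 4 ∷ []) ∷ cut (0 ∷ 13 ∷ 4 ∷ []) ∷ cut (0 ∷ 13 ∷ 4 ∷ []) ∷
          cut (0 ∷ 13 ∷ 4 ∷ []) ∷ cut (0 ∷ 13 ∷ 4 ∷ []) ∷ cut (0 ∷ 13 ∷ 4 ∷ []) ∷ []) ∷
        cut (0 ∷ 13 ∷ 3 ∷ []) ∷ cut (0 ∷ 13 ∷ 3 ∷ []) ∷ cut (0 ∷ 13 ∷ 3 ∷ []) ∷
        cut (0 ∷ 13 ∷ 3 ∷ []) ∷ cut (0 ∷ 13 ∷ 3 ∷ []) ∷ cut (0 ∷ 13 ∷ 3 ∷ []) ∷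
        cut (0 ∷ 13 ∷ 3 ∷ []) ∷ node [] ∷ node [] ∷ cut (1 ∷ 0 ∷ 2 ∷ 15 ∷ []) ∷ node [] ∷ []) ∷
      cut (0 ∷ 13 ∷ 2 ∷ []) ∷ cut (0 ∷ 13 ∷ 2 ∷ []) ∷ cut (0 ∷ 13 ∷ 2 ∷ []) ∷
      cut (0 ∷ 13 ∷ 2 ∷ []) ∷ cut (0 ∷ 13 ∷ 2 ∷ []) ∷ cut (0 ∷ 13 ∷ 2 ∷ []) ∷ node [] ∷ node [] ∷ []) ∷
    -- Second row `120000111100`, meeting the first in two columns: no representative.
    node (
      cut (1 ∷ 2 ∷ []) ∷ cut (1 ∷ 2 ∷ []) ∷ cut (0 ∷ 2 ∷ []) ∷ cut (1 ∷ 2 ∷ []) ∷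
      cut (0 ∷ 2 ∷ []) ∷ cut (1 ∷ 2 ∷ []) ∷ cut (0 ∷ 2 ∷ []) ∷ cut (0 ∷ 2 ∷ []) ∷
      cut (1 ∷ 2 ∷ []) ∷
      node (
        cut (2 ∷ 3 ∷ []) ∷ cut (2 ∷ 3 ∷ []) ∷ cut (2 ∷ 3 ∷ []) ∷ cut (2 ∷ 3 ∷ []) ∷
        cut (2 ∷ 3 ∷ []) ∷ cut (2 ∷ 3 ∷ []) ∷ cut (2 ∷ 3 ∷ []) ∷ []) ∷ []) ∷
    -- Second row `000000111111`, disjoint from the first: every third row is defective or leaves
    -- too few candidates.
    node [] ∷ []) ∷ []

-- The whole case analysis is this evaluation. All twelve rows are missing, hence the argument 11.
search-succeeds : search [] 11 (columnStates (columns [])) (normalised 12 6) tree ≡ true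
search-succeeds = refl

-- Sorting and normalising the rows

exchange : Fin 12 → Fin 12 → Move
exchange i j = move (transpose i j) plus Perm.id plus

negateRow : Fin 12 → Move
negateRow i = move Perm.id (minusAt i) Perm.id plus

moveRow-+ : ∀ π i u → moveRow (move π plus Perm.id plus) i u ≡ u
moveRow-+ π i u = Vec.tabulate∘lookup u

minusAt-≡ : ∀ i → minusAt i i ≡ Sign.-
minusAt-≡ i rewrite dec-true (i ≟ i) refl = refl

minusAt-≢ : ∀ {i k} → i ≢ k → minusAt i k ≡ Sign.+
minusAt-≢ {i} {k} i≢k rewrite dec-false (i ≟ k) i≢k = refl

moveRow-minus : ∀ i k u → minusAt i k ≡ Sign.- → moveRow (negateRow i) k u ≡ negate u
moveRow-minus i k u eq = trans
  (Vec.tabulate-cong λ j → cong (λ s → (s Sign.* Sign.+) • lookup u j) eq)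
  (trans (Vec.tabulate-∘ (Sign.- •_) (lookup u)) (cong negate (Vec.tabulate∘lookup u)))

moveRow-plus : ∀ i k u → minusAt i k ≡ Sign.+ → moveRow (negateRow i) k u ≡ u
moveRow-plus i k u eq = trans
  (Vec.tabulate-cong λ j → cong (λ s → (s Sign.* Sign.+) • lookup u j) eq) (Vec.tabulate∘lookup u)

transpose-left : ∀ {n} (i j : Fin n) → transpose i j ⟨$⟩ʳ i ≡ j
transpose-left i j rewrite dec-true (i ≟ i) refl = refl

transpose-other : ∀ {n} {i j k : Fin n} → k ≢ i → k ≢ j → transpose i j ⟨$⟩ʳ k ≡ k
transpose-other {i = i} {j} {k} k≢i k≢j rewrite dec-false (k ≟ i) k≢i | dec-false (k ≟ j) k≢j = refl

-- Rows before `i` are untouched, and row `i` is replaced by the smaller row `j`.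
exchange-improves : ∀ M i j → i Fin.< j → lookup M j <ᵣ lookup M i → act (exchange i j) M <ₘ M
exchange-improves M i j i<j Mj<Mi = <ₘ-at i
  (λ {k} k<i → trans (moved k) (cong (lookup M) (transpose-other (Fin.<⇒≢ k<i) (Fin.<⇒≢ (ℕ.<-trans k<i i<j)))))
  (subst (_<ᵣ lookup M i) (sym (trans (moved i) (cong (lookup M) (transpose-left i j)))) Mj<Mi)
  where
  moved : ∀ k → lookup (act (exchange i j) M) k ≡ lookup M (transpose i j ⟨$⟩ʳ k)
  moved k = trans (lookup-act (exchange i j) M k) (moveRow-+ (transpose i j) k (lookup M (transpose i j ⟨$⟩ʳ k)))

negateRow-improves : ∀ M i → negate (lookup M i) <ᵣ lookup M i → act (negateRow i) M <ₘ M
negateRow-improves M i neg< = <ₘ-at i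
  (λ {k} k<i → trans (lookup-act (negateRow i) M k) (moveRow-plus i k (lookup M k) (minusAt-≢ (Fin.<⇒≢ k<i ∘ sym))))
  (subst (_<ᵣ lookup M i) (sym (trans (lookup-act (negateRow i) M i) (moveRow-minus i i (lookup M i) (minusAt-≡ i)))) neg<)

-- Either no improving move of a given kind turns up, or one is produced explicitly.
all-or-exists : ∀ {n} {P Q : Fin n → Set} → (∀ i → P i ⊎ Q i) → (∀ i → P i) ⊎ ∃ Q
all-or-exists {zero}  f = inj₁ λ ()
all-or-exists {suc n} f with f zero | all-or-exists (f ∘ suc)
... | inj₂ q | _            = inj₂ (zero , q)
... | inj₁ _ | inj₂ (i , q) = inj₂ (suc i , q)
... | inj₁ p | inj₁ ps      = inj₁ λ { zero → p ; (suc i) → ps i }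

toList≡tabulate : ∀ {A : Set} {n} (xs : Vec A n) → toList xs ≡ List.tabulate (lookup xs)
toList≡tabulate []       = refl
toList≡tabulate (x ∷ xs) = cong (x ∷_) (toList≡tabulate xs)

-- Consequences of the Gram condition

IsGram : Vec Row 12 → Set
IsGram M = ∀ i j → gram (toMatrix M) i j ≡ scalarId 12 (+ 6) i j

module _ (M : Vec Row 12) (isGram : IsGram M) where

  norm : ∀ i → ⟨ lookup M i , lookup M i ⟩ ≡ + 6
  norm i = trans (isGram i i) (diagonal i)
    where
    diagonal : ∀ i → scalarId 12 (+ 6) i i ≡ + 6
    diagonal i with i ≟ i
    ... | yes _   = refl
    ... | no i≢i = contradiction refl i≢i

  inner : ∀ {i j} → i ≢ j → ⟨ lookup M i , lookup M j ⟩ ≡ + 0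
  inner {i} {j} i≢j = trans (isGram i j) off
    where
    off : scalarId 12 (+ 6) i j ≡ + 0
    off with i ≟ j
    ... | yes i≡j = contradiction i≡j i≢j
    ... | no _    = refl

  row-weight : ∀ i → weight (lookup M i) ≡ 6
  row-weight i = ℤ.+-injective (trans (sym (norm≡weight (lookup M i))) (norm i))

  -- Two equal rows would have inner product 6 and also 0.
  rows-distinct : ∀ {i j} → i ≢ j → lookup M i ≢ lookup M j
  rows-distinct {i} {j} i≢j Mi≡Mj with trans (sym (norm i)) (trans (cong ⟨ lookup M i ,_⟩ Mi≡Mj) (inner i≢j))
  ... | ()

  rows-orthogonal : AllPairs Orthogonal (toList M)
  rows-orthogonal = subst (AllPairs Orthogonal) (sym (toList≡tabulate M))
    (AllPairs.tabulate⁺ {f = lookup M} λ {i} {j} i≢j → orthogonal-complete (lookup M i) (lookup M j) (inner i≢j))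

  normalised-or-improvable : (∀ i → lookup M i ∈ normalised 12 6) ⊎ ∃ λ i → act (negateRow i) M <ₘ M
  normalised-or-improvable = all-or-exists {Q = λ i → act (negateRow i) M <ₘ M} λ i →
    case i (normalised-or-negate (lookup M i) (row-weight i))
    where
    case : ∀ i → lookup M i ∈ normalised 12 6 ⊎ negate (lookup M i) <ᵣ lookup M i →
           lookup M i ∈ normalised 12 6 ⊎ act (negateRow i) M <ₘ M
    case i (inj₁ p) = inj₁ p
    case i (inj₂ q) = inj₂ (negateRow-improves M i q)

  sorted-or-improvable : (∀ i j → i Fin.< j → lookup M i <ᵣ lookup M j) ⊎ ∃₂ λ i j → act (exchange i j) M <ₘ M
  sorted-or-improvable = all-or-exists λ i → all-or-exists λ j → pair i j
    where
    pair : ∀ i j → (i Fin.< j → lookup M i <ᵣ lookup M j) ⊎ act (exchange i j) M <ₘ M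
    pair i j with i Fin.<? j
    ... | no i≮j  = inj₁ λ i<j → contradiction i<j i≮j
    ... | yes i<j with <ᵣ-compare (lookup M i) (lookup M j)
    ...   | tri< Mi<Mj _ _ = inj₁ λ _ → Mi<Mj
    ...   | tri≈ _ Mi≋Mj _ = contradiction (Pointwise-≡⇒≡ Mi≋Mj) (rows-distinct (Fin.<⇒≢ i<j))
    ...   | tri> _ _ Mj<Mi = inj₂ (exchange-improves M i j i<j Mj<Mi)

  rows-⊆ : (∀ i → lookup M i ∈ normalised 12 6) → (∀ i j → i Fin.< j → lookup M i <ᵣ lookup M j) →
           toList M ⊆ normalised 12 6
  rows-⊆ norm sorted = subst (_⊆ normalised 12 6) (sym (toList≡tabulate M))
    (sorted-⊆ (AllPairs.tabulate⁺-< λ {i} {j} → sorted i j) (normalised-sorted 12 6) (All.tabulate⁺ norm))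

-- Reduction to the eight representatives

W : Fin 8 → Matrix 12
W a = toMatrix (table a)

classify : ∀ M → Acc _<ₘ_ M → IsGram M → ∃ λ a → Similar (W a) (toMatrix M)
classify M (acc smaller) isGram = conclude (normalised-or-improvable M isGram) (sorted-or-improvable M isGram)
  where
  Goal : Set
  Goal = ∃ λ a → Similar (W a) (toMatrix M)
  improve : ∀ g → act g M <ₘ M → Goal
  -- A move preserves the Gram condition, so the induction hypothesis applies to the smaller matrix;
  -- the similarity is then carried back along the move.
  improve g better = map₂ (λ e → similar-trans e (act-similar g M))
    (classify (act g M) (smaller better) (similar-gram (act-similar g M) isGram))
  found : ∀ a → M ≡ table a → Goal
  found a refl = a , pointwise-similar λ i j → refl
  conclude : (∀ i → lookup M i ∈ normalised 12 6) ⊎ ∃ (λ i → act (negateRow i) M <ₘ M) →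
             (∀ i j → i Fin.< j → lookup M i <ᵣ lookup M j) ⊎ ∃₂ (λ i j → act (exchange i j) M <ₘ M) → Goal
  conclude (inj₂ (i , better)) _ = improve (negateRow i) better
  conclude _ (inj₂ (i , j , better)) = improve (exchange i j) better
  -- The rows are now increasing with leading entry 1, so they embed in the candidate list. The
  -- search may still call `improve`.
  conclude (inj₁ norm) (inj₁ sorted) = search-from-empty 11 (normalised 12 6) tree
    search-succeeds (Vec.length-toList M) (rows-orthogonal M isGram) (rows-⊆ M isGram norm sorted)
    where open Soundness M Goal improve found

-- From integer matrices to ternary ones

toTrit : ∀ {x} → IsTernary x → ∃ λ t → ⟦ t ⟧ ≡ x
toTrit (inj₁ x≡1)         = pos , sym x≡1
toTrit (inj₂ (inj₁ x≡-1)) = neg , sym x≡-1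
toTrit (inj₂ (inj₂ x≡0))  = nil , sym x≡0

fromWeighing : ∀ {A : Matrix 12} → IsWeighing 12 6 A → ∃ λ M → Similar (toMatrix M) A × IsGram M
fromWeighing {A} (ternary , isGram) = M , M~A , similar-gram M~A isGram
  where
  entries : Fin 12 → Fin 12 → Trit
  entries i j = proj₁ (toTrit (ternary i j))
  M : Vec Row 12
  M = tabulate (tabulate ∘ entries)
  M~A : Similar (toMatrix M) A
  M~A = pointwise-similar λ i j → trans
    (cong ⟦_⟧ (trans (cong (λ u → lookup u j) (Vec.lookup∘tabulate (tabulate ∘ entries) i))
                     (Vec.lookup∘tabulate (entries i) j)))
    (proj₂ (toTrit (ternary i j)))

-- The representatives are weighing matrices and pairwise inequivalent

trit-ternary : ∀ t → IsTernary ⟦ t ⟧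
trit-ternary pos = inj₁ refl
trit-ternary neg = inj₂ (inj₁ refl)
trit-ternary nil = inj₂ (inj₂ refl)

W-gram : ∀ a → IsGram (table a)
W-gram = toWitness {a? = Fin.all? λ a → Fin.all? λ i → Fin.all? λ j → gram (W a) i j ℤ.≟ scalarId 12 (+ 6) i j} _

-- Values of `supportTriples` in the order of `digits`; they are pairwise distinct.
tripleCounts : Vec ℕ 8
tripleCounts = 576 ∷ 456 ∷ 504 ∷ 756 ∷ 420 ∷ 180 ∷ 468 ∷ 540 ∷ []

W-supportTriples : ∀ a → supportTriples (W a) ≡ lookup tripleCounts a
W-supportTriples = toWitness {a? = Fin.all? λ a → supportTriples (W a) ℕ.≟ lookup tripleCounts a} _

tripleCounts-injective : ∀ a b → lookup tripleCounts a ≡ lookup tripleCounts b → a ≡ b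
tripleCounts-injective = toWitness
  {a? = Fin.all? λ a → Fin.all? λ b → lookup tripleCounts a ℕ.≟ lookup tripleCounts b →-dec a ≟ b} _

theorem5p1 : Σ (Fin 8 → Matrix 12) λ W →
    (∀ a → IsWeighing 12 6 (W a)) ×
    (∀ a b → Equivalent 12 (W a) (W b) → a ≡ b) ×
    (∀ M → IsWeighing 12 6 M → ∃ λ a → Equivalent 12 M (W a))
theorem5p1 = W , weighing , inequivalent , complete
  where
  weighing : ∀ a → IsWeighing 12 6 (W a)
  weighing a = (λ i j → trit-ternary (lookup (lookup (table a) i) j)) , W-gram a
  inequivalent : ∀ a b → Equivalent 12 (W a) (W b) → a ≡ b
  inequivalent a b e = tripleCounts-injective a b (trans (sym (W-supportTriples a))
    (trans (similar-supportTriples {A = W a} {W b} (equivalent⇒similar e)) (W-supportTriples b)))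
  complete : ∀ M → IsWeighing 12 6 M → ∃ λ a → Equivalent 12 M (W a)
  complete A weighing = let M , M~A , isGram = fromWeighing weighing in
    map₂ (λ W~M → similar⇒equivalent (similar-sym (similar-trans W~M M~A))) (classify M (<ₘ-wellFounded M) isGram)
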